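{- Let $(X,\mathcal{I})$ be a Polish ideal space with $\mathcal{I}$ c.c.c., and let $Y$ be an uncountable Polish space. Suppose $F$ is an analytic subset of $X\times Y$ satisfying the following conditions: (1) $F^y\in\mathcal{I}$ for every $y\in Y$; (2) $X\setminus\pi_X(F)\in\mathcal{I}$, where $\pi_X:X\times Y\rightarrow X$ is the projection map; (3) $F_x$ is finite for every $x\in X$. Then there exists a set $T\subseteq Y$ such that $F^{ -1}(T)$ is completely $\mathcal{I}$-nonmeasurable.
   Context: $\mathcal{B}(X)$ is the Borel $\sigma$-algebra of $X$. A pair $(X,\mathcal{I})$ is a Polish ideal space if $X$ is an uncountable Polish space and $\mathcal{I}$ is a proper $\sigma$-ideal of subsets of $X$ that contains all singletons and has a Borel base, i.e. every $A\in\mathcal{I}$ is contained in a Borel set belonging to $\mathcal{I}$. Put $\mathcal{B}_+(X)=\mathcal{B}(X)\setminus\mathcal{I}$. The ideal $\mathcal{I}$ is c.c.c. if every family of pairwise disjoint sets from $\mathcal{B}_+(X)$ is countable. For $F\subseteq X\times Y$, $x\in X$, $y\in Y$ and $T\subseteq Y$ put $F_x=\{y\in Y:(x,y)\in F\}$, $F^y=\{x\in X:(x,y)\in F\}$ and $F^{ -1}(T)=\{x\in X:F_x\cap T\neq\emptyset\}$. A set $A\subseteq X$ is completely $\mathcal{I}$-nonmeasurable if for every $B\in\mathcal{B}_+(X)$ both $A\cap B\neq\emptyset$ and $(X\setminus A)\cap B\neq\emptyset$. -}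

module Defs where

open import Level using (Level; 0ℓ; _⊔_) renaming (suc to lsuc)
open import Data.List.Base using (List)
open import Data.List.Membership.Propositional using () renaming (_∈_ to _∈ˡ_)
open import Data.Nat.Base using (ℕ) renaming (_≤_ to _≤ⁿ_)
open import Data.Product using (∃; ∃-syntax; Σ-syntax; _×_; _,_; proj₁; proj₂)
open import Data.Rational.Base using (ℚ; 0ℚ; 1ℚ; _+_; _-_; -_; _<_; _≤_)
import Data.Rational.Properties as ℚ
open import Function.Bundles using (_⇔_)
open import Relation.Binary.PropositionalEquality
  using (_≡_; _≢_; refl; sym; trans; cong; subst)
open import Relation.Nullary using (¬_)
open import Relation.Unary
  using (Pred; _∈_; _∉_; _⊆_; _≐_; _≬_; _⊥_; _∩_; _⊢_; ∁; ⋃; ｛_｝; U;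
         Empty; Universal; Satisfiable; _⟨×⟩_)

-- Real numbers as Dedekind cuts.  Only the upper half of the cut is
-- stored: `above` is the set of rationals strictly greater than the number.
-- Classically it determines the lower half.

record ℝ : Set₁ where
  field
    above     : Pred ℚ 0ℓ
    inhabited : Satisfiable above
    bounded   : ∃[ b ] (∀ {q} → q ∈ above → b ≤ q)
    upward    : ∀ {p q} → p < q → p ∈ above → q ∈ above
    rounded   : ∀ {q} → q ∈ above → ∃[ p ] p < q × p ∈ above

open ℝ public

infix 4 _≤ᴿ_ _≈ᴿ_ _<ᴿ_
infixl 6 _+ᴿ_

_≤ᴿ_ : ℝ → ℝ → Set
x ≤ᴿ y = above y ⊆ above x

_≈ᴿ_ : ℝ → ℝ → Set
x ≈ᴿ y = above x ≐ above y

_<ᴿ_ : ℝ → ℚ → Set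
x <ᴿ q = q ∈ above x

0ᴿ : ℝ
0ᴿ = record
  { above     = 0ℚ <_
  ; inhabited = 1ℚ , ℚ.positive⁻¹ 1ℚ
  ; bounded   = 0ℚ , ℚ.<⇒≤
  ; upward    = λ p<q 0<p → ℚ.<-trans 0<p p<q
  ; rounded   = λ 0<q → let (p , 0<p , p<q) = ℚ.<-dense 0<q in p , p<q , 0<p
  }

private
  +-cancel : ∀ r s → r + (s - r) ≡ s
  +-cancel r s =
    trans (cong (r +_) (ℚ.+-comm s (- r)))
      (trans (sym (ℚ.+-assoc r (- r) s))
        (trans (cong (_+ s) (ℚ.+-inverseʳ r)) (ℚ.+-identityˡ s)))

  <-shift : ∀ q {r s} → r < s → q < q + (s - r)
  <-shift q {r} {s} r<s =
    subst (_< q + (s - r)) (ℚ.+-identityʳ q)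
      (ℚ.+-monoʳ-< q
        (subst (_< s - r) (ℚ.+-inverseʳ r) (ℚ.+-monoˡ-< (- r) r<s)))

_+ᴿ_ : ℝ → ℝ → ℝ
x +ᴿ y = record
  { above     = λ r → ∃[ p ] ∃[ q ] p ∈ above x × q ∈ above y × p + q ≡ r
  ; inhabited =
      let (p , p∈x) = inhabited x ; (q , q∈y) = inhabited y
      in p + q , p , q , p∈x , q∈y , refl
  ; bounded   =
      let (b , b≤) = bounded x ; (c , c≤) = bounded y
      in b + c , λ { (p , q , p∈x , q∈y , refl) → ℚ.+-mono-≤ (b≤ p∈x) (c≤ q∈y) }
  ; upward    = λ { {r} {s} r<s (p , q , p∈x , q∈y , refl) →
      p , q + (s - r) , p∈x , upward y (<-shift q r<s) q∈y ,
      trans (sym (ℚ.+-assoc p q (s - r))) (+-cancel r s) }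
  ; rounded   = λ { (p , q , p∈x , q∈y , refl) →
      let (p′ , p′<p , p′∈x) = rounded x p∈x
      in p′ + q , ℚ.+-monoˡ-< q p′<p , p′ , q , p′∈x , q∈y , refl }
  }

-- Subsets of X are predicates on X; all notions below are invariant under
-- extensional equality _≐_ of predicates.

Subset : ∀ {ℓ} → Set ℓ → Set (lsuc ℓ)
Subset {ℓ} X = Pred X ℓ

Family : ∀ {ℓ} → Set ℓ → Set (lsuc (lsuc ℓ))
Family {ℓ} X = Pred (Subset X) (lsuc ℓ)

image : ∀ {a b p} {A : Set a} {B : Set b} → (A → B) → Pred A p → Pred B (a ⊔ b ⊔ p)
image f P b = ∃[ a ] a ∈ P × f a ≡ b

IsCountable : ∀ {a p} {A : Set a} → Pred A p → Set (a ⊔ p)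
IsCountable {A = A} P =
  Σ[ f ∈ (A → ℕ) ] (∀ {x y} → x ∈ P → y ∈ P → f x ≡ f y → x ≡ y)

IsUncountable : ∀ {a} → Set a → Set a
IsUncountable A = ¬ IsCountable {A = A} U

IsFinite : ∀ {a p} {A : Set a} → Pred A p → Set (a ⊔ p)
IsFinite {A = A} P = Σ[ xs ∈ List A ] (∀ {x} → x ∈ P → x ∈ˡ xs)

record TopologicalSpace (ℓ : Level) : Set (lsuc (lsuc ℓ)) where
  field
    Carrier     : Set ℓ
    Open        : Family Carrier
    open-resp-≐ : ∀ {A B} → A ≐ B → Open A → Open B
    open-all    : ∀ {A} → Universal A → Open A
    open-∩      : ∀ {A B} → Open A → Open B → Open (A ∩ B)
    open-⋃      : {J : Set ℓ} (A : J → Subset Carrier) →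
                  (∀ j → Open (A j)) → Open (⋃ J A)

open TopologicalSpace public

infixr 2 _×ᵗ_

_×ᵗ_ : ∀ {ℓ} → TopologicalSpace ℓ → TopologicalSpace ℓ → TopologicalSpace ℓ
S ×ᵗ T = record
  { Carrier     = Carrier S × Carrier T
  ; Open        = λ W → ∀ {z} → z ∈ W →
      ∃[ A ] ∃[ B ] Open S A × Open T B × z ∈ (A ⟨×⟩ B) × (A ⟨×⟩ B) ⊆ W
  ; open-resp-≐ = λ { (V⊆W , W⊆V) oV z∈W →
      let (A , B , oA , oB , z∈ , ⊆V) = oV (W⊆V z∈W)
      in A , B , oA , oB , z∈ , λ w∈ → V⊆W (⊆V w∈) }
  ; open-all    = λ all {z} _ →
      (λ x → x ≡ x) , (λ y → y ≡ y) ,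
      open-all S (λ _ → refl) , open-all T (λ _ → refl) , (refl , refl) , λ {w} _ → all w
  ; open-∩      = λ { oV oW (z∈V , z∈W) →
      let (A , B , oA , oB , (a , b) , ⊆V) = oV z∈V
          (A′ , B′ , oA′ , oB′ , (a′ , b′) , ⊆W) = oW z∈W
      in A ∩ A′ , B ∩ B′ , open-∩ S oA oA′ , open-∩ T oB oB′ , ((a , a′) , (b , b′)) ,
         λ { ((c , c′) , (d , d′)) → ⊆V (c , d) , ⊆W (c′ , d′) } }
  ; open-⋃      = λ { W oW (j , z∈W) →
      let (A , B , oA , oB , z∈ , ⊆W) = oW j z∈W
      in A , B , oA , oB , z∈ , λ w∈ → j , ⊆W w∈ }
  }

Continuous : ∀ {ℓ} (S T : TopologicalSpace ℓ) → (Carrier S → Carrier T) → Set (lsuc ℓ)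
Continuous S T f = ∀ {A} → Open T A → Open S (f ⊢ A)

record Metric {ℓ} (X : Set ℓ) : Set (ℓ ⊔ lsuc 0ℓ) where
  field
    d          : X → X → ℝ
    d-nonneg   : ∀ x y → 0ᴿ ≤ᴿ d x y
    d-zero     : ∀ x y → d x y ≈ᴿ 0ᴿ ⇔ x ≡ y
    d-sym      : ∀ x y → d x y ≈ᴿ d y x
    d-triangle : ∀ x y z → d x z ≤ᴿ d x y +ᴿ d y z

module _ {ℓ} {X : Set ℓ} (m : Metric X) where
  open Metric m

  MetricOpen : Subset X → Set ℓ
  MetricOpen A = ∀ {x} → x ∈ A → ∃[ ε ] 0ℚ < ε × (∀ {y} → d x y <ᴿ ε → y ∈ A)

  Cauchy : (ℕ → X) → Set
  Cauchy s = ∀ {ε} → 0ℚ < ε →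
    ∃[ N ] (∀ {i j} → N ≤ⁿ i → N ≤ⁿ j → d (s i) (s j) <ᴿ ε)

  ConvergesTo : (ℕ → X) → X → Set
  ConvergesTo s x = ∀ {ε} → 0ℚ < ε → ∃[ N ] (∀ {i} → N ≤ⁿ i → d (s i) x <ᴿ ε)

  Complete : Set ℓ
  Complete = ∀ s → Cauchy s → ∃[ x ] ConvergesTo s x

IsCompletelyMetrizable : ∀ {ℓ} → TopologicalSpace ℓ → Set (lsuc ℓ)
IsCompletelyMetrizable S =
  Σ[ m ∈ Metric (Carrier S) ] Complete m × (∀ A → Open S A ⇔ MetricOpen m A)

IsSeparable : ∀ {ℓ} → TopologicalSpace ℓ → Set (lsuc ℓ)
IsSeparable S =
  Σ[ D ∈ Subset (Carrier S) ]
    IsCountable D × (∀ {A} → Open S A → Satisfiable A → D ≬ A)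

IsPolish : ∀ {ℓ} → TopologicalSpace ℓ → Set (lsuc ℓ)
IsPolish S = IsSeparable S × IsCompletelyMetrizable S

-- The least family containing the open sets and closed under complements
-- and countable unions; `resp` makes it respect extensional equality.
data Borel {ℓ} (S : TopologicalSpace ℓ) : Family (Carrier S) where
  fromOpen : ∀ {A} → Open S A → Borel S A
  compl    : ∀ {A} → Borel S A → Borel S (∁ A)
  ⋃-borel  : ∀ {A : ℕ → Subset (Carrier S)} → (∀ n → Borel S (A n)) → Borel S (⋃ ℕ A)
  resp     : ∀ {A B} → A ≐ B → Borel S A → Borel S B

-- Continuous images of Polish spaces (the empty space is Polish here, so
-- the empty set is analytic).
IsAnalytic : ∀ {ℓ} (S : TopologicalSpace ℓ) → Subset (Carrier S) → Set (lsuc (lsuc ℓ))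
IsAnalytic {ℓ} S A =
  Σ[ Z ∈ TopologicalSpace ℓ ] IsPolish Z ×
  (Σ[ f ∈ (Carrier Z → Carrier S) ] Continuous Z S f × A ≐ image f U)

-- `Empty A → A ∈ 𝓘` says ∅ ∈ 𝓘, in a form that avoids lifting ∅ to level ℓ;
-- likewise `Universal` for the whole space.
record IsProperσIdeal {ℓ} {X : Set ℓ} (𝓘 : Family X) : Set (lsuc ℓ) where
  field
    empty      : ∀ {A} → Empty A → A ∈ 𝓘
    hereditary : ∀ {A B} → A ⊆ B → B ∈ 𝓘 → A ∈ 𝓘
    ⋃-closed   : ∀ {A : ℕ → Subset X} → (∀ n → A n ∈ 𝓘) → ⋃ ℕ A ∈ 𝓘
    proper     : ∀ {A} → Universal A → A ∉ 𝓘

record IsPolishIdealSpace {ℓ} (X : TopologicalSpace ℓ) (𝓘 : Family (Carrier X)) :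
                          Set (lsuc ℓ) where
  field
    polish      : IsPolish X
    uncountable : IsUncountable (Carrier X)
    σ-ideal     : IsProperσIdeal 𝓘
    singletons  : ∀ x → ｛ x ｝ ∈ 𝓘
    borelBase   : ∀ {A} → A ∈ 𝓘 → ∃[ B ] B ∈ Borel X × B ∈ 𝓘 × A ⊆ B

module _ {ℓ} (X : TopologicalSpace ℓ) (𝓘 : Family (Carrier X)) where

  Borel₊ : Family (Carrier X)
  Borel₊ B = B ∈ Borel X × B ∉ 𝓘

  -- Members of Borel₊ are nonempty when 𝓘 contains ∅, so a family that is
  -- pairwise disjoint as an indexed family has no repetitions, and it is
  -- countable exactly when its index set is.
  IsCCC : Set (lsuc ℓ)
  IsCCC = {J : Set ℓ} (A : J → Subset (Carrier X)) →
    (∀ j → A j ∈ Borel₊) → (∀ {i j} → i ≢ j → A i ⊥ A j) → IsCountable {A = J} U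

  CompletelyNonmeasurable : Subset (Carrier X) → Set (lsuc ℓ)
  CompletelyNonmeasurable A = ∀ {B} → B ∈ Borel₊ → A ≬ B × ∁ A ≬ B

module _ {ℓ} {X Y : Set ℓ} (F : Subset (X × Y)) where

  vertical : X → Subset Y
  vertical x y = (x , y) ∈ F

  horizontal : Y → Subset X
  horizontal y x = (x , y) ∈ F

  preimage : Subset Y → Subset X
  preimage T x = vertical x ≬ T

{-# OPTIONS --safe #-}

-- Excluded middle for all types decides Σ-types, so it yields global choice, and with it a
-- well-ordering of every type.
--
-- Let U range over the finite unions of basic balls of Y.  By c.c.c. the coanalytic set
-- {x : F_x ⊆ U} contains a Borel set L_U that differs from it by a set in 𝓘.  Given S ∉ 𝓘,
-- discard from S a set in 𝓘 to obtain points x, x′ with disjoint fibres (F_x is finite and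
-- every F^y is in 𝓘); separating the finite sets F_x and F_x′ by disjoint U, U′ gives
-- subsets S ∩ L_U, S ∩ L_U′ of S that are not in 𝓘.  Iterating this inside B ∈ Borel₊ along
-- the binary tree produces a copy of the Cantor set in B over which the fibres of F are
-- nonempty and pairwise disjoint, and it is determined by a function from the nodes of the
-- tree to ℕ.
--
-- There are only continuum many such functions, so a Bernstein construction meets all the
-- copies: at stage i fewer than continuum many points of X and Y have been used, their finite
-- fibres meet fewer than continuum many of the disjoint fibres over the i-th copy, and
-- there remain a point x to keep out of the preimage of T and a point y to put into T.

module Submission where

open import Defs
open import Axiom.ExcludedMiddle using (ExcludedMiddle)
open import Axiom.Extensionality.Propositional using (Extensionality; implicit-extensionality)
open import Axiom.UniquenessOfIdentityProofs.WithK using () renaming (uip to ≡-irrelevant)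
open import Data.Bool.Base using (Bool; true; false; not; if_then_else_)
open import Data.Bool.Properties using (not-¬)
import Data.Empty as Empty
open import Data.Integer.Base as ℤ using (ℤ)
import Data.Integer.Properties as ℤ
open import Data.List.Base using (List; []; _∷_; length)
open import Data.List.Membership.Propositional using () renaming (_∈_ to _∈ˡ_)
open import Data.List.Relation.Unary.Any using (here; there)
open import Data.Maybe.Base using (Maybe; just; nothing)
open import Data.Nat.Base as ℕ using (ℕ; zero; suc)
import Data.Nat.Coprimality as Coprimality
import Data.Nat.Properties as ℕ
open import Data.Product using (∃; ∃-syntax; Σ-syntax; _×_; _,_; proj₁; proj₂)
open import Data.Rational.Base using (ℚ; mkℚ; 0ℚ; ½; *≤*; *<*; positive; _+_; _*_; _-_; -_; _<_; _≤_)
import Data.Rational.Properties as ℚ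
open import Data.Sum.Base using (_⊎_; inj₁; inj₂)
open import Data.Unit.Base using (⊤; tt)
open import Function.Base using (_∘_; id)
open import Function.Bundles using (module Equivalence)
open import Induction.WellFounded using (WellFounded; Acc; acc; module All; module FixPoint)
open import Level using (Lift; lift; lower; 0ℓ; _⊔_) renaming (suc to lsuc)
open import Relation.Binary.Definitions using (tri<; tri≈; tri>)
open import Relation.Binary.PropositionalEquality
  using (_≡_; _≢_; refl; sym; trans; cong; cong₂; subst)
open import Relation.Nullary using (yes; no; does; ¬_; contradiction)
open import Relation.Unary
  using (Pred; _∈_; _∉_; _⊆_; _⊥_; _∩_; ∁; ⋃; Empty; Satisfiable)

-- Rational radii and complete metric spaces.

radius : ℕ → ℚ
radius n = mkℚ (ℤ.+ 1) n (Coprimality.1-coprimeTo (suc n))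

radius-pos : ∀ n → 0ℚ < radius n
radius-pos n = ℚ.positive⁻¹ (radius n)

radius-antitone : ∀ {m n} → m ℕ.≤ n → radius n ≤ radius m
radius-antitone m≤n =
  *≤* (ℤ.*-monoˡ-≤-nonNeg (ℤ.+ 1) (ℤ.+≤+ (ℕ.s≤s m≤n)))

archimedean : ∀ {ε} → 0ℚ < ε → ∃[ n ] radius n ≤ ε
archimedean {mkℚ (ℤ.+ zero) d _} (*<* (ℤ.+<+ ()))
archimedean {mkℚ (ℤ.+ suc k) d _} _ =
  d , *≤* (ℤ.*-monoʳ-≤-nonNeg (ℤ.+ suc d) {ℤ.+ 1} {ℤ.+ suc k} (ℤ.+≤+ (ℕ.s≤s ℕ.z≤n)))
archimedean {mkℚ (ℤ.-[1+ k ]) d _} (*<* ())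

half : ∀ {ε} → 0ℚ < ε → ∃[ δ ] 0ℚ < δ × δ + δ ≡ ε
half {ε} 0<ε =
  ½ * ε ,
  ℚ.positive⁻¹ (½ * ε) {{ℚ.pos*pos⇒pos ½ ε {{positive 0<ε}}}} ,
  trans (sym (ℚ.*-distribʳ-+ ε ½ ½)) (ℚ.*-identityˡ ε)

antitone : ∀ {ℓ} {X : Set ℓ} (P : ℕ → Subset X) → (∀ n → P (suc n) ⊆ P n) →
  ∀ {i n} → i ℕ.≤ n → P n ⊆ P i
antitone P decreasing {i} i≤n = go (ℕ.≤⇒≤′ i≤n)
  where
  go : ∀ {k} → i ℕ.≤′ k → P k ⊆ P i
  go (ℕ.≤′-reflexive refl) = id
  go (ℕ.≤′-step i≤k) = go i≤k ∘ decreasing _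

module MetricSpace {ℓ} {X : Set ℓ} (m : Metric X) where
  open Metric m

  near : ℚ → X → X → Set
  near q x y = d x y <ᴿ q

  near-sym : ∀ {q x y} → near q x y → near q y x
  near-sym {x = x} {y} = proj₁ (d-sym x y)

  near-refl : ∀ {q x} → 0ℚ < q → near q x x
  near-refl {x = x} = proj₂ (Equivalence.from (d-zero x x) refl)

  near-trans : ∀ {p q x y z} → near p x y → near q y z → near (p + q) x z
  near-trans {x = x} {y} {z} a b = d-triangle x y z (_ , _ , a , b , refl)

  near-mono : ∀ {p q x y} → p ≤ q → near p x y → near q x y
  near-mono {p} {q} {x} {y} p≤q a with ℚ.<-cmp p q
  ... | tri< p<q _ _ = upward (d x y) p<q a
  ... | tri≈ _ refl _ = a
  ... | tri> _ _ q<p = contradiction (ℚ.<-≤-trans q<p p≤q) (ℚ.<-irrefl refl)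

  near-separated : ∀ {x y} → (∀ {q} → 0ℚ < q → near q x y) → x ≡ y
  near-separated {x} {y} all =
    Equivalence.to (d-zero x y) (d-nonneg x y , λ 0<q → all 0<q)

  _∼⟨_⟩_ : X → ℕ → X → Set
  x ∼⟨ n ⟩ y = near (radius n) x y

  ∼-refl : ∀ {n x} → x ∼⟨ n ⟩ x
  ∼-refl {n} = near-refl (radius-pos n)

  ∼-antitone : ∀ {n k x y} → n ℕ.≤ k → x ∼⟨ k ⟩ y → x ∼⟨ n ⟩ y
  ∼-antitone n≤k = near-mono (radius-antitone n≤k)

  -- Four steps suffice when two balls meet: from a point to its approximating centre, to the common
  -- point, to the other centre, to the other point.
  four-steps : ∀ {ε} → 0ℚ < ε → ∃[ n ] (∀ {x a b c y} →
    x ∼⟨ n ⟩ a → a ∼⟨ n ⟩ b → b ∼⟨ n ⟩ c → c ∼⟨ n ⟩ y → near ε x y)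
  four-steps 0<ε with half 0<ε
  ... | δ , 0<δ , refl with half 0<δ
  ... | η , 0<η , refl with archimedean 0<η
  ... | n , rn≤η = n , λ p q r s →
    near-mono (ℚ.+-mono-≤ (ℚ.+-mono-≤ rn≤η rn≤η) (ℚ.+-mono-≤ rn≤η rn≤η))
      (near-trans (near-trans p q) (near-trans r s))

  two-steps : ∀ {ε} → 0ℚ < ε → ∃[ n ] (∀ {x a y} →
    x ∼⟨ n ⟩ a → a ∼⟨ n ⟩ y → near ε x y)
  two-steps 0<ε with four-steps 0<ε
  ... | n , f = n , λ {x} {a} {y} p q →
    f p q (∼-refl {n} {y}) (∼-refl {n} {y})

  Ball : ℕ → X → Subset X
  Ball n x y = Lift ℓ (x ∼⟨ n ⟩ y)

  ball-open : ∀ n x → MetricOpen m (Ball n x)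
  ball-open n x {y} (lift a) with rounded (d x y) a
  ... | p , p<r , b = r - p , 0<r-p , λ c →
    lift (subst (λ q → near q x _) p+[r-p]≡r (near-trans b c))
    where
    r : ℚ
    r = radius n
    0<r-p : 0ℚ < r - p
    0<r-p = subst (_< r - p) (ℚ.+-inverseʳ p) (ℚ.+-monoˡ-< (- p) p<r)
    p+[r-p]≡r : p + (r - p) ≡ r
    p+[r-p]≡r = trans (cong (p +_) (ℚ.+-comm r (- p)))
      (trans (sym (ℚ.+-assoc p (- p) r))
        (trans (cong (_+ r) (ℚ.+-inverseʳ p)) (ℚ.+-identityˡ r)))

  limit-unique : ∀ {s x y} → ConvergesTo m s x → ConvergesTo m s y → x ≡ y
  limit-unique {s} {x} {y} s→x s→y = near-separated near-xy
    where
    near-xy : ∀ {q} → 0ℚ < q → near q x y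
    near-xy 0<q with half 0<q
    ... | δ , 0<δ , refl =
      let (M , f) = s→x 0<δ ; (N , g) = s→y 0<δ
      in near-trans (near-sym (f (ℕ.m≤m⊔n M N))) (g (ℕ.m≤n⊔m M N))

  -- The centres `c i` and `c j` are both close to a point of a later `P`, so they form a Cauchy
  -- sequence. The sets are not assumed closed, and the limit may lie outside them.
  nested-limit : Complete m → (P : ℕ → Subset X) (c : ℕ → X) →
    (∀ n → P (suc n) ⊆ P n) → (∀ n → Satisfiable (P n)) →
    (∀ n → P (suc n) ⊆ Ball n (c n)) →
    ∃[ z ] ConvergesTo m c z × (∀ {O} → MetricOpen m O → z ∈ O → ∃[ n ] P n ⊆ O)
  nested-limit complete P c dec nonempty P⊆ball =
    let (z , c→z) = complete c cauchy in z , c→z , shrink z c→z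
    where
    close : ∀ {i n w} → i ℕ.≤ n → w ∈ P (suc n) → c i ∼⟨ i ⟩ w
    close i≤n w∈ = lower (P⊆ball _ (antitone P dec (ℕ.s≤s i≤n) w∈))

    cauchy : Cauchy m c
    cauchy 0<ε with two-steps 0<ε
    ... | N , f = N , λ {i} {j} N≤i N≤j →
      let (w , w∈) = nonempty (suc (i ℕ.⊔ j))
      in f (∼-antitone N≤i (close (ℕ.m≤m⊔n i j) w∈))
           (near-sym (∼-antitone N≤j (close (ℕ.m≤n⊔m i j) w∈)))

    shrink : ∀ z → ConvergesTo m c z →
             ∀ {O} → MetricOpen m O → z ∈ O → ∃[ n ] P n ⊆ O
    shrink z c→z oO z∈O with oO z∈O
    ... | ε , 0<ε , ball⊆O with two-steps 0<ε
    ... | N , f with c→z (radius-pos N)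
    ... | M , g = suc (M ℕ.⊔ N) , λ w∈ → ball⊆O
      (f (near-sym (g (ℕ.m≤m⊔n M N)))
         (∼-antitone (ℕ.m≤n⊔m M N) (close ℕ.≤-refl w∈)))

-- Injective codings into ℕ.

double : ℕ → ℕ
double zero = zero
double (suc n) = suc (suc (double n))

double-injective : ∀ {m n} → double m ≡ double n → m ≡ n
double-injective {zero} {zero} _ = refl
double-injective {suc m} {suc n} eq =
  cong suc (double-injective (ℕ.suc-injective (ℕ.suc-injective eq)))

double≢suc-double : ∀ m n → double m ≢ suc (double n)
double≢suc-double (suc m) (suc n) eq =
  double≢suc-double m n (ℕ.suc-injective (ℕ.suc-injective eq))

-- pair i j = 2ⁱ (2j + 1)
pair : ℕ → ℕ → ℕ
pair zero j = suc (double j)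
pair (suc i) j = double (pair i j)

pair-injective : ∀ {i i′ j j′} → pair i j ≡ pair i′ j′ → i ≡ i′ × j ≡ j′
pair-injective {zero} {zero} eq = refl , double-injective (ℕ.suc-injective eq)
pair-injective {zero} {suc i′} eq = contradiction (sym eq) (double≢suc-double (pair i′ _) _)
pair-injective {suc i} {zero} eq = contradiction eq (double≢suc-double (pair i _) _)
pair-injective {suc i} {suc i′} eq with pair-injective {i} {i′} (double-injective eq)
... | refl , eq′ = refl , eq′

Encoding : ∀ {a} → Set a → Set a
Encoding A = Σ[ f ∈ (A → ℕ) ] (∀ {x y} → f x ≡ f y → x ≡ y)

ℕ-encoding : Encoding ℕ
ℕ-encoding = id , id

×-encoding : ∀ {a b} {A : Set a} {B : Set b} → Encoding A → Encoding B → Encoding (A × B)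
×-encoding (f , f-inj) (g , g-inj) =
  (λ (a , b) → pair (f a) (g b)) ,
  λ eq → let (p , q) = pair-injective eq in cong₂ _,_ (f-inj p) (g-inj q)

List-encoding : ∀ {a} {A : Set a} → Encoding A → Encoding (List A)
List-encoding {A = A} (f , f-inj) = code , code-injective
  where
  code : List A → ℕ
  code [] = zero
  code (x ∷ xs) = suc (pair (f x) (code xs))
  code-injective : ∀ {xs ys} → code xs ≡ code ys → xs ≡ ys
  code-injective {[]} {[]} _ = refl
  code-injective {x ∷ xs} {y ∷ ys} eq =
    let (p , q) = pair-injective (ℕ.suc-injective eq)
    in cong₂ _∷_ (f-inj p) (code-injective q)

Maybe-encoding : ∀ {a} {A : Set a} → Encoding A → Encoding (Maybe A)
Maybe-encoding {A = A} (f , f-inj) = code , code-injective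
  where
  code : Maybe A → ℕ
  code nothing = zero
  code (just x) = suc (f x)
  code-injective : ∀ {x y} → code x ≡ code y → x ≡ y
  code-injective {nothing} {nothing} _ = refl
  code-injective {just x} {just y} eq = cong just (f-inj (ℕ.suc-injective eq))

Bool-encoding : Encoding Bool
Bool-encoding = (λ { false → 0 ; true → 1 }) ,
  λ { {false} {false} _ → refl ; {true} {true} _ → refl }

-- Classical truth values and choice.

module Classical (em : ∀ {a} → ExcludedMiddle a) (ext : ∀ {a b} → Extensionality a b) where

  by-contradiction : ∀ {a} {P : Set a} → ¬ ¬ P → P
  by-contradiction {P = P} ¬¬p with em {P = P}
  ... | yes p = p
  ... | no ¬p = contradiction ¬p ¬¬p

  not-all : ∀ {a b} {A : Set a} {P : Pred A b} → ¬ (∀ x → P x) → ∃[ x ] ¬ P x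
  not-all ¬all = by-contradiction λ ¬∃ → ¬all λ x → by-contradiction λ ¬p → ¬∃ (x , ¬p)

  -- Passing to `truth P ≡ true` brings a proposition from any universe level down to `Set` and
  -- makes its proofs unique.
  truth : ∀ {a} → Set a → Bool
  truth P = does (em {P = P})

  truth-intro : ∀ {a} {P : Set a} → P → truth P ≡ true
  truth-intro {P = P} p with em {P = P}
  ... | yes _ = refl
  ... | no ¬p = contradiction p ¬p

  truth-elim : ∀ {a} {P : Set a} → truth P ≡ true → P
  truth-elim {P = P} eq with em {P = P}
  truth-elim _ | yes p = p
  truth-elim () | no _

  choose : ∀ {a b} {A : Set a} → A → (P : Pred A b) → Σ[ x ∈ A ] (∃ P → P x)
  choose x₀ P with em {P = ∃ P}
  ... | yes (x , p) = x , λ _ → p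
  ... | no ¬∃ = x₀ , λ ∃P → contradiction ∃P ¬∃

  module _ {a b} {A : Set a} {B : Set b} (enc : Encoding A) (default : B) (F : A → B) where

    -- Closure of σ-ideals and of Borel sets is stated for unions over ℕ; this reindexes a family
    -- over any encoded type, with a harmless `default` at numbers that code nothing.
    enumerate : ℕ → B
    enumerate n with em {P = ∃[ x ] proj₁ enc x ≡ n}
    ... | yes (x , _) = F x
    ... | no _ = default

    enumerate-code : ∀ x → enumerate (proj₁ enc x) ≡ F x
    enumerate-code x with em {P = ∃[ y ] proj₁ enc y ≡ proj₁ enc x}
    ... | yes (y , eq) = cong F (proj₂ enc eq)
    ... | no ¬∃ = contradiction (x , refl) ¬∃

    enumerate-all : ∀ {p} (P : Pred B p) → P default → (∀ x → P (F x)) → ∀ n → P (enumerate n)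
    enumerate-all P d f n with em {P = ∃[ x ] proj₁ enc x ≡ n}
    ... | yes (x , _) = f x
    ... | no _ = d

  -- Cantor space and absorption of a countable factor.

  2^ω : Set
  2^ω = ℕ → Bool

  0^ω : 2^ω
  0^ω _ = false

  characteristic : ∀ {a} {A : Set a} → Encoding A → (A → Bool) → 2^ω
  characteristic enc = enumerate enc false

  characteristic-injective : ∀ {a} {A : Set a} (enc : Encoding A) {P Q : A → Bool} →
    characteristic enc P ≡ characteristic enc Q → P ≡ Q
  characteristic-injective enc {P} {Q} eq = ext λ x →
    trans (sym (enumerate-code enc false P x))
      (trans (cong (λ u → u (proj₁ enc x)) eq) (enumerate-code enc false Q x))

  flatten : (ℕ → 2^ω) → 2^ω
  flatten u = characteristic (×-encoding ℕ-encoding ℕ-encoding) λ (i , j) → u i j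

  flatten-injective : ∀ {u v} → flatten u ≡ flatten v → u ≡ v
  flatten-injective eq = ext λ i → ext λ j →
    cong (λ w → w (i , j))
      (characteristic-injective (×-encoding ℕ-encoding ℕ-encoding) eq)

  _Embeds-in_ : ∀ {a b p} (A : Set a) {B : Set b} → Pred B p → Set (a ⊔ b ⊔ p)
  _Embeds-in_ A {B} P = Σ[ h ∈ (A → B) ] (∀ x → h x ∈ P) × (∀ {x y} → h x ≡ h y → x ≡ y)

  -- König's diagonal argument applied to 2^ω ≅ (2^ω)^ℕ.
  absorb-ℕ : ∀ {b p} {B : Set b} {P : Pred B p} (h : 2^ω → B) (k : 2^ω → ℕ) →
    (∀ t → h t ∈ P) → (∀ {t u} → h t ≡ h u → k t ≡ k u → t ≡ u) → 2^ω Embeds-in P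
  absorb-ℕ h k h∈P inj with em {P = ∃[ n ] (∀ v → ∃[ u ] u n ≡ v × k (flatten u) ≡ n)}
  -- Every v is row n of some u whose flattening has `k`-value n; `k` is constant on these
  -- flattenings, so `h` is injective there.
  ... | yes (n , onto) =
    (λ v → h (flatten (proj₁ (onto v)))) , (λ _ → h∈P _) , λ {v} {w} eq →
    let (u , u≡v , ku≡n) = onto v ; (u′ , u′≡w , ku′≡n) = onto w
    in trans (sym u≡v) (trans (cong (λ z → z n)
         (flatten-injective (inj eq (trans ku≡n (sym ku′≡n))))) u′≡w)
  -- Otherwise choose as row i one that no u with `k (flatten u) ≡ i` has; the result is
  -- contradictory at its own `k`-value.
  ... | no ¬onto = contradiction (diagonal , refl , refl) (proj₂ (missed n))
    where
    missed : ∀ n → ∃[ v ] ¬ (∃[ u ] u n ≡ v × k (flatten u) ≡ n)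
    missed n = not-all λ onto → ¬onto (n , onto)
    diagonal : ℕ → 2^ω
    diagonal i = proj₁ (missed i)
    n : ℕ
    n = k (flatten diagonal)

  -- Well-orders, transfinite recursion and Zermelo's theorem.

  record WellOrder {a} (A : Set a) : Set (lsuc a) where
    field
      _≺_          : A → A → Set
      -- In a recursion the earlier values are functions of proofs of `j ≺ i`; with unique proofs
      -- they depend on `j` alone.
      ≺-irrelevant : ∀ {x y} (p q : x ≺ y) → p ≡ q
      ≺-wf         : WellFounded _≺_
      compare      : ∀ x y → x ≺ y ⊎ x ≡ y ⊎ y ≺ x

    minimal : ∀ {p} (P : Pred A p) → ∃ P → ∃[ x ] P x × (∀ {y} → y ≺ x → ¬ P y)
    minimal P (x , px) = by-contradiction λ none →
      All.wfRec ≺-wf _ (λ z → ¬ P z) (λ z below pz → none (z , pz , λ {_} → below)) x px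

    transfinite : ∀ {v q} {V : Set v} (Q : ∀ x → (∀ {y} → y ≺ x → V) → V → Set q) →
      (∀ x (g : ∀ {y} → y ≺ x → V) → ∃ (Q x g)) →
      Σ[ G ∈ (A → V) ] (∀ x → Q x (λ {y} _ → G y) (G x))
    transfinite {V = V} Q step = G , λ x →
      subst (Q x _) (sym (unfold x)) (proj₂ (step x (λ {y} _ → G y)))
      where
      f : ∀ x → (∀ {y} → y ≺ x → V) → V
      f x g = proj₁ (step x g)
      G : A → V
      G = All.wfRec ≺-wf _ (λ _ → V) f
      unfold : ∀ x → G x ≡ f x (λ {y} _ → G y)
      unfold x = FixPoint.unfold-wfRec ≺-wf (λ _ → V) f
        (λ x eq → cong (f x) (implicit-extensionality ext (ext λ y<x → eq y<x)))

  -- Zermelo's theorem: the initial segments are the subsets obtained from ∅ by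
  -- repeatedly adjoining a chosen new point and taking unions.
  module Zermelo {a} (A : Set a) (x₀ : A) where

    Sub : Set a
    Sub = A → Bool

    _∋_ _∌_ : Sub → A → Set
    S ∋ x = S x ≡ true
    S ∌ x = S x ≡ false

    ∋∌-absurd : ∀ S x → S ∋ x → ¬ S ∌ x
    ∋∌-absurd S x p q with trans (sym p) q
    ... | ()

    _≼_ : Sub → Sub → Set a
    S ≼ T = ∀ x → S ∋ x → T ∋ x

    ≼-antisym : ∀ {S T} → S ≼ T → T ≼ S → S ≡ T
    ≼-antisym {S} {T} p q = ext λ x → go (p x) (q x)
      where
      go : ∀ {b c} → (b ≡ true → c ≡ true) → (c ≡ true → b ≡ true) → b ≡ c
      go {true} f _ = sym (f refl)
      go {false} {true} _ g = g refl
      go {false} {false} _ _ = refl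

    new : Sub → A
    new S = proj₁ (choose x₀ (S ∌_))

    new-∌ : ∀ S {x} → S ∌ x → S ∌ new S
    new-∌ S p = proj₂ (choose x₀ (S ∌_)) (_ , p)

    grow : Sub → Sub
    grow S x = truth (S ∋ x ⊎ x ≡ new S)

    ⋁ : (Sub → Bool) → Sub
    ⋁ Q x = truth (∃[ S ] Q S ≡ true × S ∋ x)

    -- The empty segment is the union of the empty family. Families are Boolean-valued so that the
    -- type stays at level a.
    data Segment : Sub → Set a where
      seg-grow : ∀ {S} → Segment S → Segment (grow S)
      seg-⋁    : (Q : Sub → Bool) → (∀ S → Q S ≡ true → Segment S) → Segment (⋁ Q)

    ≼-grow : ∀ S → S ≼ grow S
    ≼-grow S x p = truth-intro (inj₁ p)

    grow-new : ∀ S → grow S ∋ new S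
    grow-new S = truth-intro (inj₂ refl)

    ≼-⋁ : ∀ Q S → Q S ≡ true → S ≼ ⋁ Q
    ≼-⋁ Q S q x p = truth-intro (_ , q , p)

    ⋁-≼ : ∀ Q {T} → (∀ S → Q S ≡ true → S ≼ T) → ⋁ Q ≼ T
    ⋁-≼ Q f x p = let (S , q , s) = truth-elim p in f S q x s

    not-≼ : ∀ (Q : Sub → Bool) {T} → ¬ (∀ S → Q S ≡ true → S ≼ T) → ∃[ S ] Q S ≡ true × ¬ S ≼ T
    not-≼ Q ¬all = let (S , ¬f) = not-all ¬all in
      S , by-contradiction (λ ¬q → ¬f λ q → contradiction q ¬q) , λ s → ¬f λ _ → s

    Comparable : Sub → Set a
    Comparable S = ∀ {T} → Segment T → T ≼ S ⊎ S ≼ T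

    -- By induction on T. The critical case is T ≼ S ≼ `grow T`: either S contains `new T`, and then
    -- `grow T ≼ S`, or S adds nothing to T and the two coincide.
    no-gap : ∀ {S} → Comparable S → ∀ {T} → Segment T → T ≼ S ⊎ grow S ≼ T
    no-gap {S} cmp (seg-grow {T} t) with no-gap cmp t
    ... | inj₂ g = inj₂ λ x p → ≼-grow T x (g x p)
    ... | inj₁ T≼S with cmp (seg-grow t)
    ... | inj₁ g = inj₁ g
    ... | inj₂ S≼g with em {P = S ∋ new T}
    ... | yes p = inj₁ λ x q → go x (truth-elim q)
      where
      go : ∀ x → T ∋ x ⊎ x ≡ new T → S ∋ x
      go x (inj₁ r) = T≼S x r
      go x (inj₂ refl) = p
    ... | no ¬p = inj₂ λ x q → subst (λ R → grow R ∋ x) S≡T q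
      where
      go : ∀ x → S ∋ x → T ∋ x ⊎ x ≡ new T → T ∋ x
      go x _ (inj₁ r) = r
      go x q (inj₂ refl) = contradiction q ¬p
      S≡T : S ≡ T
      S≡T = ≼-antisym (λ x q → go x q (truth-elim (S≼g x q))) T≼S
    no-gap {S} cmp (seg-⋁ Q segs) with em {P = ∀ R → Q R ≡ true → R ≼ S}
    ... | yes f = inj₁ (⋁-≼ Q f)
    ... | no ¬f with not-≼ Q ¬f
    ... | R , q , ¬R≼S with no-gap cmp (segs R q)
    ... | inj₁ R≼S = contradiction R≼S ¬R≼S
    ... | inj₂ g = inj₂ λ x p → ≼-⋁ Q R q x (g x p)

    comparable : ∀ {S} → Segment S → Comparable S
    comparable (seg-grow {S} s) t with no-gap (comparable s) t
    ... | inj₁ T≼S = inj₁ λ x p → ≼-grow S x (T≼S x p)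
    ... | inj₂ g = inj₂ g
    comparable (seg-⋁ Q segs) {T} t with em {P = ∀ R → Q R ≡ true → R ≼ T}
    ... | yes f = inj₂ (⋁-≼ Q f)
    ... | no ¬f with not-≼ Q ¬f
    ... | R , q , ¬R≼T with comparable (segs R q) t
    ... | inj₁ T≼R = inj₁ λ x p → ≼-⋁ Q R q x (T≼R x p)
    ... | inj₂ R≼T = contradiction R≼T ¬R≼T

    Precedes : A → A → Set a
    Precedes x y = ∃[ T ] Segment T × T ∋ x × T ∌ y

    _≺_ : A → A → Set
    x ≺ y = truth (Precedes x y) ≡ true

    -- Whatever precedes `new S` lies in a segment T omitting `new S`, and T ≼ S by `no-gap`, so
    -- induction on the segment applies.
    segment-acc : ∀ {S} → Segment S → ∀ x → S ∋ x → Acc _≺_ x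
    segment-acc (seg-grow {S} s) x p with truth-elim p
    ... | inj₁ q = segment-acc s x q
    ... | inj₂ refl = acc λ {y} y≺x →
      let (T , t , T∋y , T∌x) = truth-elim y≺x in go y T t T∋y T∌x
      where
      go : ∀ y T → Segment T → T ∋ y → T ∌ new S → Acc _≺_ y
      go y T t T∋y T∌x with no-gap (comparable s) t
      ... | inj₁ T≼S = segment-acc s y (T≼S y T∋y)
      ... | inj₂ g = contradiction T∌x (∋∌-absurd T (new S) (g _ (grow-new S)))
    segment-acc (seg-⋁ Q segs) x p =
      let (R , q , r) = truth-elim p in segment-acc (segs R q) x r

    dichotomy : ∀ S x → S ∋ x ⊎ S ∌ x
    dichotomy S x with S x
    ... | true = inj₁ refl
    ... | false = inj₂ refl

    everything : Sub
    everything = ⋁ (λ S → truth (Segment S))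

    everything-segment : Segment everything
    everything-segment = seg-⋁ _ λ S q → truth-elim q

    everything-∋ : ∀ x → everything ∋ x
    everything-∋ x with dichotomy everything x
    ... | inj₁ p = p
    ... | inj₂ p = contradiction (new-∌ everything p)
      (∋∌-absurd everything (new everything)
        (≼-⋁ _ (grow everything) (truth-intro (seg-grow everything-segment)) _ (grow-new everything)))

    below-family : A → Sub → Bool
    below-family x S = truth (Segment S × S ∌ x)

    below : A → Sub
    below x = ⋁ (below-family x)

    below-segment : ∀ x → Segment (below x)
    below-segment x = seg-⋁ _ λ S q → proj₁ (truth-elim q)

    below-precedes : ∀ {x y} → below x ∋ y → Precedes y x
    below-precedes p = let (S , q , S∋y) = truth-elim p ; (s , S∌x) = truth-elim q in S , s , S∋y , S∌x

    below-∌ : ∀ x → below x ∌ x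
    below-∌ x with dichotomy (below x) x
    ... | inj₂ p = p
    ... | inj₁ p = let (T , _ , q , r) = below-precedes p in contradiction r (∋∌-absurd T x q)

    grow-below-∋ : ∀ x → grow (below x) ∋ x
    grow-below-∋ x with dichotomy (grow (below x)) x
    ... | inj₁ p = p
    ... | inj₂ p = contradiction (new-∌ (below x) (below-∌ x))
      (∋∌-absurd (below x) (new (below x)) (≼-⋁ (below-family x) (grow (below x))
        (truth-intro (seg-grow (below-segment x) , p)) _ (grow-new (below x))))

    -- `below x` is the largest segment omitting `x`, so `x` is the one point that `grow` adds to
    -- it. Either y is in `below x`, or it is outside `grow (below x)`, or it is that point.
    compare : ∀ x y → x ≺ y ⊎ x ≡ y ⊎ y ≺ x
    compare x y with dichotomy (below x) y
    ... | inj₁ p = inj₂ (inj₂ (truth-intro (below-precedes p)))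
    ... | inj₂ y∉ with dichotomy (grow (below x)) y
    ... | inj₂ y∉g = inj₁ (truth-intro (_ , seg-grow (below-segment x) , grow-below-∋ x , y∉g))
    ... | inj₁ y∈g = inj₂ (inj₁ (trans (is-new (below-∌ x) (truth-elim (grow-below-∋ x)))
                                       (sym (is-new y∉ (truth-elim y∈g)))))
      where
      is-new : ∀ {z} → below x ∌ z → below x ∋ z ⊎ z ≡ new (below x) → z ≡ new (below x)
      is-new z∉ (inj₁ z∈) = contradiction z∉ (∋∌-absurd (below x) _ z∈)
      is-new _ (inj₂ eq) = eq

    well-order : WellOrder A
    well-order = record
      { _≺_ = _≺_
      ; ≺-irrelevant = λ p q → ≡-irrelevant p q
      ; ≺-wf = λ x → segment-acc everything-segment x (everything-∋ x)
      ; compare = compare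
      }

  open Zermelo using (well-order)

  module 2^ω-order = WellOrder (well-order 2^ω 0^ω)
  open 2^ω-order using () renaming (_≺_ to _≺ω_) public

  -- The least initial segment of size continuum, or all of 2^ω if no proper one has it.
  small-segments : Σ[ Active ∈ Pred 2^ω 0ℓ ] Σ[ e ∈ (2^ω → 2^ω) ]
    (∀ {i} → i ∈ Active → ¬ (2^ω Embeds-in (_≺ω i))) × (∀ v → ∃[ i ] i ∈ Active × e i ≡ v)
  small-segments with em {P = ∃[ i ] (2^ω Embeds-in (_≺ω i))}
  ... | no ¬∃ = (λ _ → ⊤) , id , (λ {i} _ h → ¬∃ (i , h)) , λ v → v , tt , refl
  ... | yes ∃i =
    -- By minimality nothing before `i` has a segment receiving 2^ω, while a left inverse of `h`
    -- maps the segment below `i` onto 2^ω.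
    let (i , (h , h≺i , h-inj) , least) = 2^ω-order.minimal (λ i → 2^ω Embeds-in (_≺ω i)) ∃i
        inverse = λ j → choose 0^ω (λ v → h v ≡ j)
    in (_≺ω i) , proj₁ ∘ inverse , least ,
       λ v → h v , h≺i v , h-inj (proj₂ (inverse (h v)) (v , refl))

  -- Polish spaces: dense sequence, basic balls, separation.

  module PolishSpace {ℓ} (S : TopologicalSpace ℓ) (polish : IsPolish S) (x₀ : Carrier S) where

    metric : Metric (Carrier S)
    metric = proj₁ (proj₂ polish)

    complete : Complete metric
    complete = proj₁ (proj₂ (proj₂ polish))

    open MetricSpace metric public

    to-metric : ∀ {A} → Open S A → MetricOpen metric A
    to-metric {A} = Equivalence.to (proj₂ (proj₂ (proj₂ polish)) A)

    from-metric : ∀ {A} → MetricOpen metric A → Open S A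
    from-metric {A} = Equivalence.from (proj₂ (proj₂ (proj₂ polish)) A)

    ball-Open : ∀ n x → Open S (Ball n x)
    ball-Open n x = from-metric (ball-open n x)

    private
      D : Subset (Carrier S)
      D = proj₁ (proj₁ polish)

      code : Carrier S → ℕ
      code = proj₁ (proj₁ (proj₂ (proj₁ polish)))

    e : ℕ → Carrier S
    e n = proj₁ (choose x₀ (λ x → x ∈ D × code x ≡ n))

    dense : ∀ n x → ∃[ j ] e j ∼⟨ n ⟩ x
    dense n x =
      let (y , y∈D , lift x∼y) =
            proj₂ (proj₂ (proj₁ polish)) (ball-Open n x) (x , lift ∼-refl)
          (ey∈D , eq) = proj₂ (choose x₀ (λ z → z ∈ D × code z ≡ code y)) (y , y∈D , refl)
          ey≡y = proj₂ (proj₁ (proj₂ (proj₁ polish))) ey∈D y∈D eq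
      in code y , subst (λ z → z ∼⟨ n ⟩ x) (sym ey≡y) (near-sym x∼y)

    basic : ℕ × ℕ → Subset (Carrier S)
    basic (j , n) = Ball n (e j)

    not-near : ∀ {x y} → x ≢ y → ∃[ ε ] 0ℚ < ε × ¬ near ε x y
    not-near x≢y = by-contradiction λ none → x≢y (near-separated λ {q} 0<q →
      by-contradiction λ ¬near → none (q , 0<q , ¬near))

    -- One side has to be a basic ball, so that only countably many null sets arise from such
    -- separations.
    hausdorff : ∀ {x w} → x ≢ w →
      ∃[ β ] x ∈ basic β × ∃[ O ] Open S O × w ∈ O × basic β ⊥ O
    hausdorff {x} {w} x≢w with not-near x≢w
    ... | ε , 0<ε , ¬near with four-steps 0<ε
    ... | n , f with dense n x
    ... | j , ej∼x = (j , n) , lift ej∼x , Ball n w , ball-Open n w , lift ∼-refl ,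
      λ { {v} (lift p , lift q) → ¬near (f (near-sym ej∼x) p (near-sym q) (∼-refl {n} {w})) }

    -- The margin of one more radius keeps in `A` a limit of points of the ball, even if the limit
    -- leaves the ball.
    basic-base : ∀ {A x} → Open S A → x ∈ A →
      ∃[ β ] x ∈ basic β × (∀ {y z} → y ∈ basic β → y ∼⟨ proj₂ β ⟩ z → z ∈ A)
    basic-base {A} {x} oA x∈A with to-metric oA x∈A
    ... | ε , 0<ε , ball⊆A with four-steps 0<ε
    ... | n , f with dense n x
    ... | j , ej∼x = (j , n) , lift ej∼x ,
      λ { {y} {z} (lift p) q → ball⊆A (f (near-sym ej∼x) p q (∼-refl {n} {z})) }

    nested : (P : ℕ → Subset (Carrier S)) (c : ℕ → Carrier S) →
      (∀ n → P (suc n) ⊆ P n) → (∀ n → Satisfiable (P n)) →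
      (∀ n → P (suc n) ⊆ Ball n (c n)) →
      ∃[ z ] ConvergesTo metric c z × (∀ {O} → Open S O → z ∈ O → ∃[ n ] P n ⊆ O)
    nested P c dec nonempty small =
      let (z , c→z , shrink) = nested-limit complete P c dec nonempty small
      in z , c→z , λ oO → shrink (to-metric oO)

    Nbhd : List ℕ × ℕ → Subset (Carrier S)
    Nbhd (js , n) x = ∃[ j ] j ∈ˡ js × x ∈ Ball n (e j)

    Nbhd-open : ∀ κ → Open S (Nbhd κ)
    Nbhd-open (js , n) = from-metric λ (j , j∈ , x∈) →
      let (ε , 0<ε , ⊆ball) = ball-open n (e j) x∈
      in ε , 0<ε , λ p → j , j∈ , ⊆ball p

    private
      Apart : ℕ → Carrier S → Carrier S → Set ℓ
      Apart n x y = x ≢ y → ∀ {a b c} → x ∼⟨ n ⟩ a → a ∼⟨ n ⟩ b → b ∼⟨ n ⟩ c → ¬ c ∼⟨ n ⟩ y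

      apart : ∀ x y → ∃[ n ] Apart n x y
      apart x y with em {P = x ≡ y}
      ... | yes x≡y = 0 , λ x≢y → contradiction x≡y x≢y
      ... | no x≢y =
        let (ε , 0<ε , ¬near) = not-near x≢y ; (n , f) = four-steps 0<ε
        in n , λ _ p q r s → ¬near (f p q r s)

      apart-mono : ∀ {m n x y} → m ℕ.≤ n → Apart m x y → Apart n x y
      apart-mono m≤n f x≢y p q r s =
        f x≢y (∼-antitone m≤n p) (∼-antitone m≤n q) (∼-antitone m≤n r) (∼-antitone m≤n s)

      uniform : ∀ (R : ℕ → Carrier S → Set ℓ) → (∀ {m n x} → m ℕ.≤ n → R m x → R n x) →
        (∀ x → ∃[ n ] R n x) → ∀ xs → ∃[ n ] (∀ {x} → x ∈ˡ xs → R n x)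
      uniform R mono f [] = 0 , λ ()
      uniform R mono f (x ∷ xs) =
        let (m , r) = f x ; (n , rs) = uniform R mono f xs
        in m ℕ.⊔ n , λ { (here refl) → mono (ℕ.m≤m⊔n m n) r
                       ; (there x∈) → mono (ℕ.m≤n⊔m m n) (rs x∈) }

      -- The list witnessing finiteness may contain points outside `P`; balls around those could
      -- spoil disjointness, so none are placed there.
      centres : ∀ (P : Subset (Carrier S)) n xs →
        ∃[ js ] (∀ {x} → x ∈ˡ xs → x ∈ P → x ∈ Nbhd (js , n)) ×
                (∀ {j} → j ∈ˡ js → ∃[ x ] x ∈ P × e j ∼⟨ n ⟩ x)
      centres P n [] = [] , (λ ()) , (λ ())
      centres P n (x ∷ xs) with centres P n xs | em {P = x ∈ P}
      ... | js , cov , near-P | no x∉P =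
        js , (λ { (here refl) x∈P → contradiction x∈P x∉P ; (there x∈) → cov x∈ }) , near-P
      ... | js , cov , near-P | yes x∈P =
        let (j , p) = dense n x
        in j ∷ js ,
           (λ { (here refl) _ → j , here refl , lift p
              ; (there x∈) y∈P → let (i , i∈ , q) = cov x∈ y∈P in i , there i∈ , q }) ,
           (λ { (here refl) → x , x∈P , p ; (there i∈) → near-P i∈ })

    -- For large n no chain of four n-steps joins a point of `xs` to a different point of `ys`, but
    -- a common point of the two neighbourhoods would yield one from `P` to `Q`.
    separate-finite : ∀ {P Q : Subset (Carrier S)} → IsFinite P → IsFinite Q → P ⊥ Q →
      ∃[ κ ] ∃[ λ′ ] P ⊆ Nbhd κ × Q ⊆ Nbhd λ′ × Nbhd κ ⊥ Nbhd λ′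
    separate-finite {P} {Q} (xs , P⊆xs) (ys , Q⊆ys) P⊥Q =
      let (n , far) = uniform (λ n x → ∀ {y} → y ∈ˡ ys → Apart n x y)
            (λ m≤n f y∈ → apart-mono m≤n (f y∈))
            (λ x → uniform (λ n y → Apart n x y) apart-mono (apart x) ys) xs
          (js , P⊆ , js-near) = centres P n xs
          (ks , Q⊆ , ks-near) = centres Q n ys
      in (js , n) , (ks , n) , (λ x∈P → P⊆ (P⊆xs x∈P) x∈P) , (λ y∈Q → Q⊆ (Q⊆ys y∈Q) y∈Q) ,
         λ { ((j , j∈ , lift p) , (k , k∈ , lift q)) →
           let (x , x∈P , r) = js-near j∈ ; (y , y∈Q , s) = ks-near k∈
           in far (P⊆xs x∈P) (Q⊆ys y∈Q) (λ x≡y → P⊥Q (x∈P , subst Q (sym x≡y) y∈Q))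
                (near-sym r) p (near-sym q) s }

  -- σ-ideals and Borel sets.

  ∅ˢ : ∀ {ℓ} {X : Set ℓ} → Subset X
  ∅ˢ _ = Lift _ Empty.⊥

  module SigmaIdeal {ℓ} {X : Set ℓ} {𝓘 : Family X} (σ : IsProperσIdeal 𝓘) where
    open IsProperσIdeal σ public

    covered : ∀ {k} {K : Set k} → Encoding K → (A : K → Subset X) → (∀ κ → A κ ∈ 𝓘) →
      ∀ {S} → (∀ {x} → x ∈ S → ∃[ κ ] x ∈ A κ) → S ∈ 𝓘
    covered enc A A∈𝓘 S⊆ = hereditary
      (λ {x} x∈S → let (κ , x∈A) = S⊆ x∈S in
        proj₁ enc κ , subst (x ∈_) (sym (enumerate-code enc ∅ˢ A κ)) x∈A)
      (⋃-closed (enumerate-all enc ∅ˢ A (_∈ 𝓘) (empty (λ _ ())) A∈𝓘))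

    covered₂ : ∀ {A B S} → A ∈ 𝓘 → B ∈ 𝓘 → (∀ {x} → x ∈ S → x ∈ A ⊎ x ∈ B) → S ∈ 𝓘
    covered₂ {A} {B} A∈𝓘 B∈𝓘 S⊆ = covered Bool-encoding (λ b → if b then B else A)
      (λ { false → A∈𝓘 ; true → B∈𝓘 })
      (λ x∈S → case-⊎ (S⊆ x∈S))
      where
      case-⊎ : ∀ {x} → x ∈ A ⊎ x ∈ B → ∃[ b ] x ∈ (if b then B else A)
      case-⊎ (inj₁ p) = false , p
      case-⊎ (inj₂ p) = true , p

    covered-list : ∀ {y} {Y : Set y} (H : Y → Subset X) → (∀ y → H y ∈ 𝓘) →
      ∀ ys {S} → (∀ {x} → x ∈ S → ∃[ y ] y ∈ˡ ys × x ∈ H y) → S ∈ 𝓘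
    covered-list H H∈𝓘 [] S⊆ = empty λ x x∈S → no-member (proj₁ (proj₂ (S⊆ x∈S)))
      where
      no-member : ∀ {y} → ¬ (y ∈ˡ [])
      no-member ()
    covered-list H H∈𝓘 (y ∷ ys) {S} S⊆ =
      covered₂ (H∈𝓘 y) (covered-list H H∈𝓘 ys {S ∩ ∁ (H y)} λ (x∈S , x∉H) → rest x∉H (S⊆ x∈S))
        split
      where
      rest : ∀ {x} → x ∉ H y → ∃[ z ] z ∈ˡ (y ∷ ys) × x ∈ H z → ∃[ z ] z ∈ˡ ys × x ∈ H z
      rest x∉H (_ , here refl , x∈H) = contradiction x∈H x∉H
      rest x∉H (z , there z∈ , x∈H) = z , z∈ , x∈H
      split : ∀ {x} → x ∈ S → x ∈ H y ⊎ x ∈ S ∩ ∁ (H y)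
      split {x} x∈S with em {P = x ∈ H y}
      ... | yes p = inj₁ p
      ... | no ¬p = inj₂ (x∈S , ¬p)

    positive-nonempty : ∀ {S} → S ∉ 𝓘 → Satisfiable S
    positive-nonempty S∉𝓘 = by-contradiction λ ¬∃ → S∉𝓘 (empty λ x x∈S → ¬∃ (x , x∈S))

    positive-piece : ∀ {k} {K : Set k} → Encoding K → (A : K → Subset X) →
      ∀ {S} → S ∉ 𝓘 → (∀ {x} → x ∈ S → ∃[ κ ] x ∈ A κ) → ∃[ κ ] S ∩ A κ ∉ 𝓘
    positive-piece enc A {S} S∉𝓘 S⊆ = by-contradiction λ none → S∉𝓘
      (covered enc (λ κ → S ∩ A κ) (λ κ → by-contradiction λ p → none (κ , p))
        λ x∈S → let (κ , x∈A) = S⊆ x∈S in κ , x∈S , x∈A)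

    positive-∖ : ∀ {S N} → S ∉ 𝓘 → N ∈ 𝓘 → S ∩ ∁ N ∉ 𝓘
    positive-∖ {S} {N} S∉𝓘 N∈𝓘 d = S∉𝓘 (covered₂ N∈𝓘 d split)
      where
      split : ∀ {x} → x ∈ S → x ∈ N ⊎ x ∈ S ∩ ∁ N
      split {x} x∈S with em {P = x ∈ N}
      ... | yes p = inj₁ p
      ... | no ¬p = inj₂ (x∈S , ¬p)

  module BorelSets {ℓ} (S : TopologicalSpace ℓ) where

    borel-∅ : Borel S ∅ˢ
    borel-∅ = resp ((λ ¬t → lift (¬t (lift tt))) , λ ())
      (compl (fromOpen (open-all S {λ _ → Lift ℓ ⊤} (λ _ → lift tt))))

    borel-⋃ : ∀ {k} {K : Set k} → Encoding K → (A : K → Subset (Carrier S)) → (∀ κ → Borel S (A κ)) →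
      ∀ {B} → (∀ {x} → x ∈ B → ∃[ κ ] x ∈ A κ) → (∀ κ → A κ ⊆ B) → Borel S B
    borel-⋃ enc A bA {B} B⊆ ⊆B = resp
      ((λ (n , x∈) → enumerate-all enc ∅ˢ A (λ C → C ⊆ B) (λ ()) ⊆B n x∈) ,
       (λ {x} x∈B → let (κ , x∈A) = B⊆ x∈B in
         proj₁ enc κ , subst (x ∈_) (sym (enumerate-code enc ∅ˢ A κ)) x∈A))
      (⋃-borel (enumerate-all enc ∅ˢ A (Borel S) borel-∅ bA))

    borel-∩∁ : ∀ {A B} → Borel S A → Borel S B → Borel S (A ∩ ∁ B)
    borel-∩∁ {A} {B} bA bB = resp
      ((λ x∉ → by-contradiction (λ x∉A → x∉ (inj₁ x∉A)) , λ x∈B → x∉ (inj₂ x∈B)) ,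
       λ { (x∈A , x∉B) (inj₁ x∉A) → x∉A x∈A ; (x∈A , x∉B) (inj₂ x∈B) → x∉B x∈B })
      (compl {A = λ x → x ∉ A ⊎ x ∈ B}
        (borel-⋃ Bool-encoding (λ b → if b then B else ∁ A)
          (λ { false → compl bA ; true → bB })
          (λ { (inj₁ p) → false , p ; (inj₂ p) → true , p })
          (λ { false → inj₁ ; true → inj₂ })))

  -- Borel hulls modulo the ideal, for arbitrary and then for analytic sets.

  module Hull {ℓ} {X : TopologicalSpace ℓ} {𝓘 : Family (Carrier X)}
              (σ : IsProperσIdeal 𝓘) (ccc : IsCCC X 𝓘) (x₀ : Carrier X) where
    open SigmaIdeal σ
    open BorelSets X
    open WellOrder (Zermelo.well-order (Carrier X) x₀)

    -- Along a well-order of X choose at each point, where possible, a positive Borel set containing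
    -- it and disjoint from `S` and from the earlier choices. By c.c.c. these are countably many, so
    -- the complement of their union is Borel.
    hull : (S : Subset (Carrier X)) →
      ∃[ H ] Borel X H × S ⊆ H × (∀ {B} → Borel X B → S ⊆ B → H ∩ ∁ B ∈ 𝓘)
    hull S = H , compl borel-⋃G , S⊆H , minimal-H
      where
      Admissible : ∀ x → (∀ {y} → y ≺ x → Subset (Carrier X)) → Subset (Carrier X) → Set (lsuc ℓ)
      Admissible x g B = Borel₊ X 𝓘 B × x ∈ B × B ⊥ S × (∀ {y} (y≺x : y ≺ x) → B ⊥ g y≺x)

      Greedy : ∀ x → (∀ {y} → y ≺ x → Subset (Carrier X)) → Subset (Carrier X) → Set (lsuc ℓ)
      Greedy x g B = Admissible x g B ⊎ (Empty B × ¬ ∃ (Admissible x g))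

      greedy : ∀ x (g : ∀ {y} → y ≺ x → Subset (Carrier X)) → ∃ (Greedy x g)
      greedy x g with em {P = ∃ (Admissible x g)}
      ... | yes (B , adm) = B , inj₁ adm
      ... | no none = ∅ˢ , inj₂ ((λ _ ()) , none)

      family : Σ[ G ∈ (Carrier X → Subset (Carrier X)) ] (∀ x → Greedy x (λ {y} _ → G y) (G x))
      family = transfinite Greedy greedy

      G : Carrier X → Subset (Carrier X)
      G = proj₁ family

      -- `IsCCC` wants an index type at level ℓ, while `Borel₊` lives one level higher; the Boolean
      -- equation also lets the point alone determine the index.
      Chosen : Set ℓ
      Chosen = Σ[ x ∈ Carrier X ] truth (Borel₊ X 𝓘 (G x)) ≡ true

      chosen-admissible : ∀ {x} → Borel₊ X 𝓘 (G x) → Admissible x (λ {y} _ → G y) (G x)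
      chosen-admissible {x} b with proj₂ family x
      ... | inj₁ adm = adm
      ... | inj₂ (none , _) = contradiction (empty none) (proj₂ b)

      Chosen-≡ : ∀ {i j : Chosen} → proj₁ i ≡ proj₁ j → i ≡ j
      Chosen-≡ {x , p} {_ , q} refl = cong (x ,_) (≡-irrelevant p q)

      disjoint : ∀ {i j : Chosen} → i ≢ j → G (proj₁ i) ⊥ G (proj₁ j)
      disjoint {i} {j} i≢j (p , q) with compare (proj₁ i) (proj₁ j)
      ... | inj₁ i≺j =
        proj₂ (proj₂ (proj₂ (chosen-admissible (truth-elim (proj₂ j))))) i≺j (q , p)
      ... | inj₂ (inj₁ eq) = i≢j (Chosen-≡ eq)
      ... | inj₂ (inj₂ j≺i) =
        proj₂ (proj₂ (proj₂ (chosen-admissible (truth-elim (proj₂ i))))) j≺i (p , q)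

      Chosen-encoding : Encoding Chosen
      Chosen-encoding =
        let (f , f-inj) = ccc (λ (j : Chosen) → G (proj₁ j)) (λ j → truth-elim (proj₂ j)) disjoint
        in f , λ eq → f-inj _ _ eq

      ⋃G : Subset (Carrier X)
      ⋃G = ⋃ Chosen (λ j → G (proj₁ j))

      borel-⋃G : Borel X ⋃G
      borel-⋃G = borel-⋃ Chosen-encoding (λ j → G (proj₁ j))
        (λ j → proj₁ (truth-elim (proj₂ j))) id (λ j x∈ → j , x∈)

      H : Subset (Carrier X)
      H = ∁ ⋃G

      S⊆H : S ⊆ H
      S⊆H x∈S (j , x∈G) =
        proj₁ (proj₂ (proj₂ (chosen-admissible (truth-elim (proj₂ j))))) (x∈G , x∈S)

      minimal-H : ∀ {B} → Borel X B → S ⊆ B → H ∩ ∁ B ∈ 𝓘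
      minimal-H {B} bB S⊆B = by-contradiction absurd
        where
        absurd : ¬ H ∩ ∁ B ∉ 𝓘
        absurd pos with positive-nonempty pos
        ... | x , x∈H , x∉B with proj₂ family x
        ... | inj₁ adm = x∈H ((x , truth-intro (proj₁ adm)) , proj₁ (proj₂ adm))
        -- A positive `H ∩ ∁ B` would itself have been admissible at its point `x`, where the
        -- recursion found nothing.
        ... | inj₂ (_ , none) = none
          (H ∩ ∁ B , (borel-∩∁ (compl borel-⋃G) bB , pos) , (x∈H , x∉B) ,
           (λ { ((_ , z∉B) , z∈S) → z∉B (S⊆B z∈S) }) ,
           λ {y} _ → avoids y)
          where
          avoids : ∀ y → (H ∩ ∁ B) ⊥ G y
          avoids y ((z∈H , _) , z∈G) with proj₂ family y
          ... | inj₁ adm = z∈H ((y , truth-intro (proj₁ adm)) , z∈G)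
          ... | inj₂ (none , _) = none _ z∈G

  -- Lusin–Sierpiński: pieces A s of the image of ∁ V, indexed by finite sequences s,
  -- are replaced by hulls; off countably many null sets a point of the root hull
  -- lies in the hulls along a branch, which determines a preimage of it.
  module AnalyticHull {ℓ} {X : TopologicalSpace ℓ} {𝓘 : Family (Carrier X)}
      (σ : IsProperσIdeal 𝓘) (ccc : IsCCC X 𝓘) (polishX : IsPolish X) (x₀ : Carrier X)
      (Z : TopologicalSpace ℓ) (polishZ : IsPolish Z) (z₀ : Carrier Z)
      (g : Carrier Z → Carrier X) (g-continuous : Continuous Z X g)
      {V : Subset (Carrier Z)} (V-open : Open Z V) where

    open SigmaIdeal σ
    open BorelSets X
    open Hull {X = X} σ ccc x₀
    module X = PolishSpace X polishX x₀
    module Z = PolishSpace Z polishZ z₀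

    E : List ℕ → Subset (Carrier Z)
    E [] = ∁ V
    E (k ∷ s) = E s ∩ Z.Ball (length s) (Z.e k)

    E⊆∁V : ∀ s → E s ⊆ ∁ V
    E⊆∁V [] = id
    E⊆∁V (k ∷ s) (z∈ , _) = E⊆∁V s z∈

    A : List ℕ → Subset (Carrier X)
    A s = image g (E s)

    Â : List ℕ → Subset (Carrier X)
    Â s = proj₁ (hull (A s))

    Â-borel : ∀ s → Borel X (Â s)
    Â-borel s = proj₁ (proj₂ (hull (A s)))

    A⊆Â : ∀ s → A s ⊆ Â s
    A⊆Â s = proj₁ (proj₂ (proj₂ (hull (A s))))

    Â-minimal : ∀ s {B} → Borel X B → A s ⊆ B → Â s ∩ ∁ B ∈ 𝓘
    Â-minimal s = proj₂ (proj₂ (proj₂ (hull (A s))))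

    Dead : List ℕ → Subset (Carrier X)
    Dead s = Â s ∩ ∁ (⋃ ℕ λ k → Â (k ∷ s))

    Dead∈𝓘 : ∀ s → Dead s ∈ 𝓘
    Dead∈𝓘 s = Â-minimal s (⋃-borel λ k → Â-borel (k ∷ s)) λ { (z , z∈ , refl) →
      let (k , p) = Z.dense (length s) z in k , A⊆Â (k ∷ s) (z , (z∈ , lift p) , refl) }

    Far : List ℕ × (ℕ × ℕ) → Subset (Carrier X)
    Far (s , β) x = x ∈ Â s × x ∈ X.basic β × X.basic β ⊥ A s

    -- If the basic ball misses `A s`, its complement is a Borel set containing `A s`, and
    -- minimality of the hull applies; otherwise `Far` is empty.
    Far∈𝓘 : ∀ κ → Far κ ∈ 𝓘
    Far∈𝓘 (s , β) with em {P = X.basic β ⊥ A s}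
    ... | yes disj = hereditary (λ (p , q , _) → p , λ ¬q → ¬q q)
      (Â-minimal s (compl (fromOpen (X.ball-Open (proj₂ β) (X.e (proj₁ β)))))
        (λ a b → disj (b , a)))
    ... | no ¬disj = empty λ x (_ , _ , disj) → ¬disj disj

    module _ {x : Carrier X} (x∈Â : x ∈ Â []) (alive : ∀ s → x ∉ Dead s)
             (not-far : ∀ κ → x ∉ Far κ) where

      path : ℕ → Σ[ s ∈ List ℕ ] x ∈ Â s
      extend : ∀ n → ∃[ k ] x ∈ Â (k ∷ proj₁ (path n))
      path zero = [] , x∈Â
      path (suc n) = proj₁ (extend n) ∷ proj₁ (path n) , proj₂ (extend n)
      extend n = by-contradiction λ none → alive (proj₁ (path n)) (proj₂ (path n) , none)

      length-path : ∀ n → length (proj₁ (path n)) ≡ n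
      length-path zero = refl
      length-path (suc n) = cong suc (length-path n)

      E-nonempty : ∀ n → Satisfiable (E (proj₁ (path n)))
      E-nonempty n = by-contradiction λ none →
        let (j , p) = X.dense 0 x
        in not-far (proj₁ (path n) , (j , 0))
             (proj₂ (path n) , lift p , λ { (_ , (z , z∈ , _)) → none (z , z∈) })

      branch-limit : ∃[ z ] ConvergesTo Z.metric (λ n → Z.e (proj₁ (extend n))) z ×
        (∀ {O} → Open Z O → z ∈ O → ∃[ n ] E (proj₁ (path n)) ⊆ O)
      branch-limit = Z.nested (λ n → E (proj₁ (path n))) (λ n → Z.e (proj₁ (extend n)))
        (λ _ → proj₁) E-nonempty
        (λ n {w} w∈ → subst (λ m → w ∈ Z.Ball m (Z.e (proj₁ (extend n)))) (length-path n) (proj₂ w∈))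

      z : Carrier Z
      z = proj₁ branch-limit

      shrink : ∀ {O} → Open Z O → z ∈ O → ∃[ n ] E (proj₁ (path n)) ⊆ O
      shrink = proj₂ (proj₂ branch-limit)

      z∉V : z ∉ V
      z∉V z∈V = let (n , E⊆V) = shrink V-open z∈V ; (w , w∈) = E-nonempty n
                in E⊆∁V (proj₁ (path n)) w∈ (E⊆V w∈)

      -- If they differed, continuity would send some `E` on the branch into an open set missed by a
      -- basic ball around `x`, putting `x` in a `Far` set.
      gz≡x : g z ≡ x
      gz≡x = by-contradiction λ gz≢x →
        let (β , x∈β , O , oO , gz∈O , β⊥O) = X.hausdorff (gz≢x ∘ sym)
            (n , E⊆O) = shrink (g-continuous oO) gz∈O
        in not-far (proj₁ (path n) , β) (proj₂ (path n) , x∈β ,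
             λ { (v∈β , (z′ , z′∈ , refl)) → β⊥O (v∈β , E⊆O z′∈) })

      preimage-exists : x ∈ image g (∁ V)
      preimage-exists = z , z∉V , gz≡x

    image-hull : ∃[ H ] Borel X H × image g (∁ V) ⊆ H × H ∩ ∁ (image g (∁ V)) ∈ 𝓘
    image-hull = Â [] , Â-borel [] , A⊆Â [] ,
      covered₂ {A = λ x → ∃[ s ] x ∈ Dead s} {B = λ x → ∃[ κ ] x ∈ Far κ}
        (covered (List-encoding ℕ-encoding) Dead Dead∈𝓘 id)
        (covered (×-encoding (List-encoding ℕ-encoding) (×-encoding ℕ-encoding ℕ-encoding))
          Far Far∈𝓘 id)
        (λ (x∈Â , x∉) → by-contradiction λ neither → x∉
          (preimage-exists x∈Â (λ s d → neither (inj₁ (s , d))) (λ κ f → neither (inj₂ (κ , f)))))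

  -- Deciding Borel sets along shrinking sequences.

  module Resolution {ℓ} (X : TopologicalSpace ℓ) (polish : IsPolish X) (x₀ : Carrier X) where
    open PolishSpace X polish x₀

    record Shrinks (P : ℕ → Subset (Carrier X)) (x : Carrier X) : Set (lsuc ℓ) where
      field
        decreasing : ∀ n → P (suc n) ⊆ P n
        nonempty   : ∀ n → Satisfiable (P n)
        converges  : ∀ {O} → Open X O → x ∈ O → ∃[ n ] P n ⊆ O

      common : ∀ m n → ∃[ w ] w ∈ P m × w ∈ P n
      common m n = let (w , w∈) = nonempty (m ℕ.⊔ n) in
        w , antitone P decreasing (ℕ.m≤m⊔n m n) w∈ , antitone P decreasing (ℕ.m≤n⊔m m n) w∈

    open Shrinks

    Covers : (ℕ → Subset (Carrier X)) → Set ℓ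
    Covers C = ∀ x → ∃[ k ] x ∈ C k

    Follows : (P : ℕ → Subset (Carrier X)) (D : ℕ → ℕ → Subset (Carrier X)) → Set ℓ
    Follows P D = ∀ n → ∃[ m ] ∃[ k ] P m ⊆ D n k

    Decides : (P : ℕ → Subset (Carrier X)) → Carrier X → Subset (Carrier X) → Set ℓ
    Decides P x A = (∃[ m ] P m ⊆ A × x ∈ A) ⊎ (∃[ m ] P m ⊆ ∁ A × x ∉ A)

    eventually : ∀ {P x A} → Shrinks P x → Decides P x A → ∀ m → P m ⊆ A → x ∈ A
    eventually s (inj₁ (_ , _ , x∈)) m P⊆ = x∈
    eventually s (inj₂ (n , P⊆∁ , _)) m P⊆ =
      let (w , w∈m , w∈n) = common s m n in contradiction (P⊆ w∈m) (P⊆∁ w∈n)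

    -- Following the covers D stands in for converging in a finer Polish topology in which A is clopen.
    Resolvable : Subset (Carrier X) → Set (lsuc ℓ)
    Resolvable A = Σ[ D ∈ (ℕ → ℕ → Subset (Carrier X)) ] (∀ n → Covers (D n)) ×
      (∀ {P x} → Shrinks P x → Follows P D → Decides P x A)

    resolve-all : ∀ {k} {K : Set k} → Encoding K → (A : K → Subset (Carrier X)) →
      (∀ κ → Resolvable (A κ)) →
      Σ[ D ∈ (ℕ → ℕ → Subset (Carrier X)) ] (∀ n → Covers (D n)) ×
        (∀ {P x} → Shrinks P x → Follows P D → ∀ κ → Decides P x (A κ))
    resolve-all {K = K} enc A res = D ,
      enumerate-all enc′ _ tasks Covers (λ x → 0 , lift tt) (λ (κ , n) → proj₁ (proj₂ (res κ)) n) ,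
      λ {P} s follows κ → proj₂ (proj₂ (res κ)) s λ n →
        subst (λ C → ∃[ m ] ∃[ k ] P m ⊆ C k) (enumerate-code enc′ _ tasks (κ , n))
          (follows (proj₁ enc′ (κ , n)))
      where
      enc′ : Encoding (K × ℕ)
      enc′ = ×-encoding enc ℕ-encoding
      tasks : K × ℕ → ℕ → Subset (Carrier X)
      tasks (κ , n) = proj₁ (res κ) n
      D : ℕ → ℕ → Subset (Carrier X)
      D = enumerate enc′ (λ _ _ → Lift ℓ ⊤) tasks

    -- One cover suffices: `∁ A` and the basic balls with a margin inside `A`. The margin pulls `x`
    -- into `A` once some `P m` is in such a ball; if `P m` is in `∁ A`, convergence excludes
    -- `x ∈ A`.
    open-resolvable : ∀ {A} → Open X A → Resolvable A
    open-resolvable {A} oA = (λ _ → enumerate enc ∅ˢ piece) , (λ _ → covers) , decide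
      where
      enc : Encoding (Maybe (ℕ × ℕ))
      enc = Maybe-encoding (×-encoding ℕ-encoding ℕ-encoding)

      Inner : ℕ × ℕ → Set ℓ
      Inner β = ∀ {y z} → y ∈ basic β → y ∼⟨ proj₂ β ⟩ z → z ∈ A

      piece : Maybe (ℕ × ℕ) → Subset (Carrier X)
      piece nothing = ∁ A
      piece (just β) y = y ∈ basic β × Inner β

      covers : Covers (enumerate enc ∅ˢ piece)
      covers x with em {P = x ∈ A}
      ... | no x∉A = _ , subst (x ∈_) (sym (enumerate-code enc ∅ˢ piece nothing)) x∉A
      ... | yes x∈A = let (β , x∈β , inner) = basic-base oA x∈A in
        _ , subst (x ∈_) (sym (enumerate-code enc ∅ˢ piece (just β)))
              (x∈β , λ {_} {_} → inner)

      decide : ∀ {P x} → Shrinks P x → Follows P (λ _ → enumerate enc ∅ˢ piece) → Decides P x A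
      decide {P} {x} s follows =
        let (m , k , P⊆) = follows 0
        in enumerate-all enc ∅ˢ piece (λ C → P m ⊆ C → Decides P x A)
             (λ P⊆∅ → contradiction (lower (P⊆∅ (proj₂ (nonempty s m)))) (λ ()))
             (λ { nothing P⊆∁A → inj₂ (m , P⊆∁A , outside m P⊆∁A)
                ; (just β) P⊆β →
                    inj₁ (m , (λ w∈ → proj₂ (P⊆β w∈) (proj₁ (P⊆β w∈)) ∼-refl) , inside m β P⊆β) })
             k P⊆
        where
        outside : ∀ m → P m ⊆ ∁ A → x ∉ A
        outside m P⊆∁A x∈A =
          let (n , P⊆A) = converges s oA x∈A ; (w , w∈m , w∈n) = common s m n
          in P⊆∁A w∈m (P⊆A w∈n)
        inside : ∀ m β → P m ⊆ piece (just β) → x ∈ A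
        inside m β P⊆β =
          let (n , P⊆ball) = converges s (ball-Open (proj₂ β) x) (lift ∼-refl)
              (w , w∈m , w∈n) = common s m n
              (w∈β , inner) = P⊆β w∈m
          in inner w∈β (near-sym (lower (P⊆ball w∈n)))

    -- One more cover, by the complement of the union and the sets `A i`, forces the sequence to
    -- commit to a single `A i` or to avoid them all.
    ⋃-resolvable : ∀ {A : ℕ → Subset (Carrier X)} → (∀ i → Resolvable (A i)) → Resolvable (⋃ ℕ A)
    ⋃-resolvable {A} res with resolve-all ℕ-encoding A res
    ... | D , covers , decides = D′ , covers′ , decides′
      where
      D′ : ℕ → ℕ → Subset (Carrier X)
      D′ zero zero = ∁ (⋃ ℕ A)
      D′ zero (suc i) = A i
      D′ (suc n) = D n

      covers′ : ∀ n → Covers (D′ n)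
      covers′ zero x with em {P = x ∈ ⋃ ℕ A}
      ... | yes (i , x∈) = suc i , x∈
      ... | no x∉ = zero , x∉
      covers′ (suc n) = covers n

      decides′ : ∀ {P x} → Shrinks P x → Follows P D′ → Decides P x (⋃ ℕ A)
      decides′ {P} {x} s follows with follows zero
      ... | m , zero , P⊆ = inj₂ (m , P⊆ , λ (i , x∈) → absurd i x∈)
        where
        absurd : ∀ i → x ∉ A i
        absurd i x∈ with decides s (follows ∘ suc) i
        ... | inj₁ (n , P⊆A , _) =
          let (w , w∈m , w∈n) = common s m n in P⊆ w∈m (i , P⊆A w∈n)
        ... | inj₂ (_ , _ , x∉) = x∉ x∈
      ... | m , suc i , P⊆ = inj₁
        (m , (λ w∈ → i , P⊆ w∈) , i , eventually s (decides s (follows ∘ suc) i) m P⊆)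

    borel-resolvable : ∀ {A} → Borel X A → Resolvable A
    borel-resolvable (fromOpen oA) = open-resolvable oA
    borel-resolvable (compl bA) =
      let (D , covers , decides) = borel-resolvable bA
      in D , covers , λ s f → complement (decides s f)
      where
      complement : ∀ {P x A} → Decides P x A → Decides P x (∁ A)
      complement (inj₁ (m , P⊆ , x∈)) = inj₂ (m , (λ w∈ w∉ → w∉ (P⊆ w∈)) , λ x∉ → x∉ x∈)
      complement (inj₂ d) = inj₁ d
    borel-resolvable (⋃-borel bA) = ⋃-resolvable λ n → borel-resolvable (bA n)
    borel-resolvable (resp (A⊆B , B⊆A) bA) =
      let (D , covers , decides) = borel-resolvable bA
      in D , covers , λ s f → transport A⊆B B⊆A (decides s f)
      where
      transport : ∀ {P x A B} → A ⊆ B → B ⊆ A → Decides P x A → Decides P x B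
      transport A⊆B _ (inj₁ (m , P⊆ , x∈)) = inj₁ (m , A⊆B ∘ P⊆ , A⊆B x∈)
      transport _ B⊆A (inj₂ (m , P⊆ , x∉)) = inj₂ (m , (λ w∈ → P⊆ w∈ ∘ B⊆A) , x∉ ∘ B⊆A)

  -- Fibres of F: Borel lower approximations and splitting.

  module Construction {ℓ} (X Y : TopologicalSpace ℓ) (𝓘 : Family (Carrier X))
      (space : IsPolishIdealSpace X 𝓘) (ccc : IsCCC X 𝓘) (polishY : IsPolish Y)
      (F : Subset (Carrier X × Carrier Y)) (analytic : IsAnalytic (X ×ᵗ Y) F)
      (horizontal∈𝓘 : ∀ y → horizontal F y ∈ 𝓘)
      (projection : ∁ (image proj₁ F) ∈ 𝓘)
      (vertical-finite : ∀ x → IsFinite (vertical F x)) where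

    open IsPolishIdealSpace space using (polish; σ-ideal; borelBase)
    open SigmaIdeal σ-ideal
    open BorelSets X

    some-point : ∃ F
    some-point = by-contradiction λ none →
      proper {A = ∁ (image proj₁ F)} (λ { _ (p , p∈F , _) → none (p , p∈F) }) projection

    x₀ : Carrier X
    x₀ = proj₁ (proj₁ some-point)

    y₀ : Carrier Y
    y₀ = proj₂ (proj₁ some-point)

    module X = PolishSpace X polish x₀
    module Y = PolishSpace Y polishY y₀
    open Resolution X polish x₀
    open Shrinks

    K : Set
    K = List ℕ × ℕ

    K-encoding : Encoding K
    K-encoding = ×-encoding (List-encoding ℕ-encoding) ℕ-encoding

    F⊆ : K → Subset (Carrier X)
    F⊆ κ x = vertical F x ⊆ Y.Nbhd κ

    -- The points whose fibre leaves `Y.Nbhd κ` form the image under `proj₁ ∘ f` of a closed set, so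
    -- they have a Borel hull up to a null set; `L` is its complement.
    lower-approximation : ∀ κ →
      ∃[ L ] Borel X L × L ⊆ F⊆ κ × F⊆ κ ∩ ∁ L ∈ 𝓘
    lower-approximation κ =
      let (Z , polishZ , f , f-continuous , F⊆f , f⊆F) = analytic
          (H , bH , S⊆H , H∖S) = AnalyticHull.image-hull {X = X} σ-ideal ccc polish x₀
            Z polishZ (proj₁ (F⊆f (proj₂ some-point))) (proj₁ ∘ f)
            (λ {A} oA → f-continuous {A = λ p → proj₁ p ∈ A} λ {p} p∈ →
              A , (λ y → y ≡ y) , oA , open-all Y (λ _ → refl) , (p∈ , refl) , proj₁)
            {V = λ z → proj₂ (f z) ∈ Y.Nbhd κ}
            (f-continuous {A = λ p → proj₂ p ∈ Y.Nbhd κ} λ {p} p∈ →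
              (λ x → x ≡ x) , Y.Nbhd κ , open-all X (λ _ → refl) , Y.Nbhd-open κ , (refl , p∈) , proj₂)
      in ∁ H , compl bH ,
         (λ {x} x∉H {y} y∈Fx → by-contradiction λ y∉ →
           let (z , _ , fz≡) = F⊆f y∈Fx
           in x∉H (S⊆H (z , (λ z∈ → y∉ (subst (λ p → proj₂ p ∈ Y.Nbhd κ) fz≡ z∈)) , cong proj₁ fz≡))) ,
         hereditary (λ {x} (x∈F⊆ , x∈H) → by-contradiction x∈H ,
           λ { (z , z∉ , refl) → z∉ (x∈F⊆ (f⊆F (z , _ , refl))) }) H∖S

    L : K → Subset (Carrier X)
    L κ = proj₁ (lower-approximation κ)

    L-borel : ∀ κ → Borel X (L κ)
    L-borel κ = proj₁ (proj₂ (lower-approximation κ))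

    L⊆ : ∀ κ → L κ ⊆ F⊆ κ
    L⊆ κ = proj₁ (proj₂ (proj₂ (lower-approximation κ)))

    Error : K → Subset (Carrier X)
    Error κ = F⊆ κ ∩ ∁ (L κ)

    Error∈𝓘 : ∀ κ → Error κ ∈ 𝓘
    Error∈𝓘 κ = proj₂ (proj₂ (proj₂ (lower-approximation κ)))

    Meets : Carrier X → Subset (Carrier X)
    Meets x x′ = ∃[ y ] (x , y) ∈ F × (x′ , y) ∈ F

    Meets∈𝓘 : ∀ x → Meets x ∈ 𝓘
    Meets∈𝓘 x = let (ys , Fx⊆ys) = vertical-finite x in
      covered-list (horizontal F) horizontal∈𝓘 ys λ (y , p , q) → y , Fx⊆ys p , q

    -- Discard from S the errors and the null sets S ∩ L κ; what remains contains points
    -- x, x′ with disjoint fibres, and any neighbourhoods separating these fibres will do.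
    split : ∀ {S} → S ∉ 𝓘 → ∃[ κ ] ∃[ λ′ ]
      S ∩ L κ ∉ 𝓘 × S ∩ L λ′ ∉ 𝓘 × Y.Nbhd κ ⊥ Y.Nbhd λ′
    split {S} S∉𝓘 =
      let S°∉𝓘 = positive-∖ S∉𝓘 Bad∈𝓘
          (x , x∈S , x-good) = positive-nonempty S°∉𝓘
          (x′ , (x′∈S , x′-good) , apart) = positive-nonempty (positive-∖ S°∉𝓘 (Meets∈𝓘 x))
          (κ , λ′ , Fx⊆ , Fx′⊆ , disj) = Y.separate-finite (vertical-finite x) (vertical-finite x′)
            (λ (p , q) → apart (_ , p , q))
      in κ , λ′ , thick x∈S x-good Fx⊆ , thick x′∈S x′-good Fx′⊆ , disj
      where
      -- The second conjunct empties the set unless `S ∩ L κ` is null, so all `κ` can be discarded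
      -- at once.
      Thin : K → Subset (Carrier X)
      Thin κ x = x ∈ S ∩ L κ × truth (S ∩ L κ ∈ 𝓘) ≡ true

      Bad : Subset (Carrier X)
      Bad x = (∃[ κ ] x ∈ Error κ) ⊎ (∃[ κ ] x ∈ Thin κ)

      Thin∈𝓘 : ∀ κ → Thin κ ∈ 𝓘
      Thin∈𝓘 κ = by-contradiction λ Thin∉𝓘 →
        let (_ , _ , t) = positive-nonempty {Thin κ} Thin∉𝓘 in Thin∉𝓘 (hereditary proj₁ (truth-elim t))

      Bad∈𝓘 : Bad ∈ 𝓘
      Bad∈𝓘 = covered₂ (covered K-encoding Error Error∈𝓘 id) (covered K-encoding Thin Thin∈𝓘 id) id

      thick : ∀ {x κ} → x ∈ S → x ∉ Bad → x ∈ F⊆ κ → S ∩ L κ ∉ 𝓘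
      thick {x} {κ} x∈S x-good x∈F⊆ null = x-good
        (inj₂ (κ , (x∈S , by-contradiction λ x∉L → x-good (inj₁ (κ , x∈F⊆ , x∉L))) , truth-intro null))

    -- Cantor schemes and fusion inside a positive Borel set.

    prefix : 2^ω → ℕ → List Bool
    prefix t zero = []
    prefix t (suc n) = t n ∷ prefix t n

    length-prefix : ∀ t n → length (prefix t n) ≡ n
    length-prefix t zero = refl
    length-prefix t (suc n) = cong suc (length-prefix t n)

    branching : ∀ {t u} → t ≢ u → ∃[ n ] prefix t n ≡ prefix u n × t n ≢ u n
    branching {t} {u} t≢u = by-contradiction λ none →
      let same : ∀ n → prefix t n ≡ prefix u n → t n ≡ u n
          same n eq = by-contradiction λ tn≢un → none (n , eq , tn≢un)
      in t≢u (ext λ n → same n (prefixes same n))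
      where
      prefixes : (∀ n → prefix t n ≡ prefix u n → t n ≡ u n) → ∀ n → prefix t n ≡ prefix u n
      prefixes same zero = refl
      prefixes same (suc n) = cong₂ _∷_ (same n (prefixes same n)) (prefixes same n)

    -- A scheme assigns to each node the index of a point of the dense sequence of X.
    Scheme : Set
    Scheme = List Bool → ℕ

    track : Scheme → 2^ω → ℕ → Carrier X
    track a t n = X.e (a (prefix t (suc n)))

    -- The Borel set in which a scheme was built is not mentioned, so there are only continuum many
    -- cases to treat.
    Good : Scheme → Set ℓ
    Good a = Σ[ Φ ∈ (2^ω → Carrier X) ]
      (∀ t → ConvergesTo X.metric (track a t) (Φ t)) ×
      (∀ t → Satisfiable (vertical F (Φ t))) ×
      (∀ {t u} → t ≢ u → vertical F (Φ t) ⊥ vertical F (Φ u))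

    module Fusion {B : Subset (Carrier X)} (B-borel : Borel X B) (B∉𝓘 : B ∉ 𝓘) where

      root : Subset (Carrier X)
      root = B ∩ ∁ (proj₁ (borelBase projection))

      root-borel : Borel X root
      root-borel = borel-∩∁ B-borel (proj₁ (proj₂ (borelBase projection)))

      root∉𝓘 : root ∉ 𝓘
      root∉𝓘 = positive-∖ B∉𝓘 (proj₁ (proj₂ (proj₂ (borelBase projection))))

      root-fibre : ∀ {x} → x ∈ root → Satisfiable (vertical F x)
      root-fibre (_ , x∉) = by-contradiction λ none →
        x∉ (proj₂ (proj₂ (proj₂ (borelBase projection)))
          λ { ((_ , y) , p , refl) → none (y , p) })

      constraint : Maybe K → Subset (Carrier X)
      constraint nothing = root
      constraint (just κ) = L κ

      resolution : Σ[ D ∈ (ℕ → ℕ → Subset (Carrier X)) ] (∀ n → Covers (D n)) ×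
        (∀ {P x} → Shrinks P x → Follows P D → ∀ κ → Decides P x (constraint κ))
      resolution = resolve-all (Maybe-encoding K-encoding) constraint
        λ { nothing → borel-resolvable root-borel ; (just κ) → borel-resolvable (L-borel κ) }

      D : ℕ → ℕ → Subset (Carrier X)
      D = proj₁ resolution

      record Child (n : ℕ) (S : Subset (Carrier X)) (κ : K) : Set (lsuc ℓ) where
        field
          set      : Subset (Carrier X)
          set∉𝓘    : set ∉ 𝓘
          set⊆S    : set ⊆ S
          set⊆L    : set ⊆ L κ
          piece    : ℕ
          set⊆D    : set ⊆ D n piece
          centre   : ℕ
          set⊆ball : set ⊆ X.Ball n (X.e centre)

      child : ∀ n {S κ} → S ∩ L κ ∉ 𝓘 → Child n S κ
      child n pos =
        let (k , pos′) = positive-piece ℕ-encoding (D n) pos (λ {x} _ → proj₁ (proj₂ resolution) n x)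
            (j , pos″) = positive-piece ℕ-encoding (λ j → X.Ball n (X.e j)) pos′
              (λ {x} _ → let (j , p) = X.dense n x in j , lift p)
        in record
          { set∉𝓘    = pos″
          ; set⊆S    = proj₁ ∘ proj₁ ∘ proj₁
          ; set⊆L    = proj₂ ∘ proj₁ ∘ proj₁
          ; set⊆D    = proj₂ ∘ proj₁
          ; set⊆ball = proj₂
          }

      Children : ℕ → Subset (Carrier X) → Set (lsuc ℓ)
      Children n S = Σ[ κ ∈ (Bool → K) ] Y.Nbhd (κ false) ⊥ Y.Nbhd (κ true) × (∀ b → Child n S (κ b))

      children : ∀ n {S} → S ∉ 𝓘 → Children n S
      children n S∉𝓘 =
        let (κ , λ′ , p , q , disj) = split S∉𝓘
        in (λ b → if b then λ′ else κ) , disj , λ { false → child n p ; true → child n q }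

      node : List Bool → Subset (Carrier X)
      node∉𝓘 : ∀ s → node s ∉ 𝓘
      offspring : ∀ s → Children (length s) (node s)
      node [] = root
      node (b ∷ s) = Child.set (proj₂ (proj₂ (offspring s)) b)
      node∉𝓘 [] = root∉𝓘
      node∉𝓘 (b ∷ s) = Child.set∉𝓘 (proj₂ (proj₂ (offspring s)) b)
      offspring s = children (length s) (node∉𝓘 s)

      label : List Bool → Bool → K
      label s = proj₁ (offspring s)

      labels-disjoint : ∀ s {b c} → b ≢ c → Y.Nbhd (label s b) ⊥ Y.Nbhd (label s c)
      labels-disjoint s {false} {false} b≢c _ = b≢c refl
      labels-disjoint s {false} {true} _ (p , q) = proj₁ (proj₂ (offspring s)) (p , q)
      labels-disjoint s {true} {false} _ (p , q) = proj₁ (proj₂ (offspring s)) (q , p)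
      labels-disjoint s {true} {true} b≢c _ = b≢c refl

      child-at : ∀ s b → Child (length s) (node s) (label s b)
      child-at s = proj₂ (proj₂ (offspring s))

      scheme : Scheme
      scheme [] = 0
      scheme (b ∷ s) = Child.centre (child-at s b)

      module Branch (t : 2^ω) where

        P : ℕ → Subset (Carrier X)
        P n = node (prefix t n)

        child-on : ∀ n → Child (length (prefix t n)) (P n) (label (prefix t n) (t n))
        child-on n = child-at (prefix t n) (t n)

        limit : ∃[ x ] ConvergesTo X.metric (track scheme t) x ×
                       (∀ {O} → Open X O → x ∈ O → ∃[ n ] P n ⊆ O)
        limit = X.nested P (track scheme t)
          (λ n → Child.set⊆S (child-on n))
          (λ n → positive-nonempty (node∉𝓘 (prefix t n)))
          (λ n {x} x∈ → subst (λ m → x ∈ X.Ball m (track scheme t n)) (length-prefix t n)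
            (Child.set⊆ball (child-on n) x∈))

        point : Carrier X
        point = proj₁ limit

        shrinks : Shrinks P point
        shrinks = record
          { decreasing = λ n → Child.set⊆S (child-on n)
          ; nonempty   = λ n → positive-nonempty (node∉𝓘 (prefix t n))
          ; converges  = proj₂ (proj₂ limit)
          }

        follows : Follows P D
        follows n = suc n , Child.piece (child-on n) , λ {x} x∈ →
          subst (λ m → x ∈ D m (Child.piece (child-on n))) (length-prefix t n)
            (Child.set⊆D (child-on n) x∈)

        -- The limit may lie outside `P m`; following the covers `D` is what carries the inclusion
        -- of `P m` in a Borel constraint over to it.
        point∈ : ∀ κ m → P m ⊆ constraint κ → point ∈ constraint κ
        point∈ κ = eventually shrinks (proj₂ (proj₂ resolution) shrinks follows κ)

        point∈root : point ∈ root
        point∈root = point∈ nothing 0 id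

        fibre⊆ : ∀ n → vertical F point ⊆ Y.Nbhd (label (prefix t n) (t n))
        -- The label chosen at level n constrains the node at level n + 1.
        fibre⊆ n = L⊆ κ (point∈ (just κ) (suc n) (Child.set⊆L (child-on n)))
          where
          κ : K
          κ = label (prefix t n) (t n)

      open Branch using (point)

      -- Where the branches first part, the two labels have disjoint neighbourhoods, each containing
      -- one of the fibres.
      points-disjoint : ∀ {t u} → t ≢ u → vertical F (point t) ⊥ vertical F (point u)
      points-disjoint {t} {u} t≢u {y} (p , q) =
        let (n , eq , tn≢un) = branching t≢u
        in labels-disjoint (prefix t n) tn≢un
             (Branch.fibre⊆ t n p ,
              subst (λ s → y ∈ Y.Nbhd (label s (u n))) (sym eq) (Branch.fibre⊆ u n q))

      scheme-good : Good scheme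
      scheme-good = point , (λ t → proj₁ (proj₂ (Branch.limit t))) ,
        (λ t → root-fibre (Branch.point∈root t)) , points-disjoint

      scheme-in-B : ∀ t → point t ∈ B
      scheme-in-B t = proj₁ (Branch.point∈root t)

    -- The Bernstein construction.

    graph : Scheme → 2^ω
    graph a = characteristic (×-encoding (List-encoding Bool-encoding) ℕ-encoding)
      λ (s , k) → truth (a s ≡ k)

    graph-injective : ∀ {a b} → graph a ≡ graph b → a ≡ b
    graph-injective {a} {b} eq = ext λ s → sym (truth-elim
      (trans (cong (λ f → f (s , a s)) (sym (characteristic-injective _ eq))) (truth-intro refl)))

    Active : Pred 2^ω 0ℓ
    Active = proj₁ small-segments

    scheme-of : 2^ω → Scheme
    scheme-of i = proj₁ (choose (λ _ → 0) λ a → graph a ≡ proj₁ (proj₂ small-segments) i)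

    scheme-of-onto : ∀ a → ∃[ i ] i ∈ Active × scheme-of i ≡ a
    scheme-of-onto a =
      let (i , act , eq) = proj₂ (proj₂ (proj₂ small-segments)) (graph a)
      in i , act , graph-injective
           (trans (proj₂ (choose _ λ b → graph b ≡ proj₁ (proj₂ small-segments) i) (a , sym eq)) eq)

    Live : 2^ω → Set ℓ
    Live i = i ∈ Active × Good (scheme-of i)

    -- Convergence replaces the map in `Good`: limits being unique, membership in `B` then depends
    -- on the scheme and not on the proof that it is good.
    OnTrack : 2^ω → Carrier X → Set
    OnTrack i x = ∃[ t ] ConvergesTo X.metric (track (scheme-of i) t) x

    -- x is kept out of the preimage of T while y, meeting a fibre over the same perfect
    -- set, is put into T.
    Stage : ∀ i → (∀ {j} → j ≺ω i → Carrier X × Carrier Y) → Carrier X × Carrier Y → Set ℓ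
    Stage i g (x , y) = Live i →
      OnTrack i x × (∃[ x′ ] OnTrack i x′ × (x′ , y) ∈ F) × (x , y) ∉ F ×
      (∀ {j} (j≺i : j ≺ω i) → (x , proj₂ (g j≺i)) ∉ F) ×
      (∀ {j} (j≺i : j ≺ω i) → (proj₁ (g j≺i) , y) ∉ F)

    position : ∀ {A : Set ℓ} {x : A} {xs} → x ∈ˡ xs → ℕ
    position (here _) = zero
    position (there x∈) = suc (position x∈)

    position-injective : ∀ {A : Set ℓ} {x y : A} {xs} (p : x ∈ˡ xs) (q : y ∈ˡ xs) →
      position p ≡ position q → x ≡ y
    position-injective (here refl) (here refl) _ = refl
    position-injective (there p) (there q) eq = position-injective p q (ℕ.suc-injective eq)

    module _ (i : 2^ω) (g : ∀ {j} → j ≺ω i → Carrier X × Carrier Y)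
             (active : i ∈ Active) (good : Good (scheme-of i)) where

      private
        Φ : 2^ω → Carrier X
        Φ = proj₁ good

        Φ-disjoint : ∀ {t u} → t ≢ u → vertical F (Φ t) ⊥ vertical F (Φ u)
        Φ-disjoint = proj₂ (proj₂ (proj₂ good))

        Φ-injective : ∀ {t u y} → (Φ t , y) ∈ F → (Φ u , y) ∈ F → t ≡ u
        Φ-injective p q = by-contradiction λ t≢u → Φ-disjoint t≢u (p , q)

        g-cong : ∀ {j k} (p : j ≺ω i) (q : k ≺ω i) → j ≡ k → g p ≡ g q
        g-cong p q refl = cong g (2^ω-order.≺-irrelevant p q)

      -- Otherwise each fibre over the copy contains an earlier y. Disjoint fibres have different
      -- stages, so 2^ω would embed below an active `i`.
      avoiding-points : ∃[ t ] (∀ {j} (j≺i : j ≺ω i) → (Φ t , proj₂ (g j≺i)) ∉ F)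
      avoiding-points = by-contradiction λ none →
        let hit : ∀ t → ∃[ j ] Σ[ j≺i ∈ j ≺ω i ] (Φ t , proj₂ (g j≺i)) ∈ F
            hit t = by-contradiction λ ¬hit → none (t , λ {_} j≺i p → ¬hit (_ , j≺i , p))
        in proj₁ (proj₂ (proj₂ small-segments)) active
             ((λ t → proj₁ (hit t)) , (λ t → proj₁ (proj₂ (hit t))) , λ {t} {u} eq →
               Φ-injective (proj₂ (proj₂ (hit t)))
                 (subst (λ v → (Φ u , proj₂ v) ∈ F) (sym (g-cong _ _ eq)) (proj₂ (proj₂ (hit u)))))

      module _ (t : 2^ω) where

        -- Flipping the first bit of `t` embeds 2^ω into the branches other than `t`, so that the
        -- fibre supplying y is disjoint from the one over `Φ t`.
        away : 2^ω → 2^ω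
        away u zero = not (t zero)
        away u (suc n) = u n

        away-injective : ∀ {u v} → away u ≡ away v → u ≡ v
        away-injective eq = ext λ n → cong (λ w → w (suc n)) eq

        t≢away : ∀ u → t ≢ away u
        t≢away u eq = not-¬ refl (cong (λ w → w zero) eq)

        -- Otherwise each fibre over `away u` meets the finite fibre of an earlier point. The stage
        -- and the place of the common y in a list determine u, and `absorb-ℕ` disposes of the
        -- place.
        avoiding-fibres : ∃[ u ] (∀ {j} (j≺i : j ≺ω i) →
          vertical F (proj₁ (g j≺i)) ⊥ vertical F (Φ (away u)))
        avoiding-fibres = by-contradiction λ none →
          proj₁ (proj₂ (proj₂ small-segments)) active (embedding λ u →
            by-contradiction λ ¬hit → none (u , λ {_} j≺i {y} (p , q) → ¬hit (_ , j≺i , y , p , q)))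
          where
          Hit : 2^ω → Set ℓ
          Hit u = ∃[ j ] Σ[ j≺i ∈ j ≺ω i ] ∃[ y ] (proj₁ (g j≺i) , y) ∈ F × (Φ (away u) , y) ∈ F

          slot : ∀ x y → (x , y) ∈ F → ℕ
          slot x y p = position (proj₂ (vertical-finite x) p)

          same-slot : ∀ {x x′ y y′} (p : (x , y) ∈ F) (p′ : (x′ , y′) ∈ F) →
            x ≡ x′ → slot x y p ≡ slot x′ y′ p′ → y ≡ y′
          same-slot p p′ refl = position-injective _ _

          embedding : (∀ u → Hit u) → 2^ω Embeds-in (_≺ω i)
          embedding hit = absorb-ℕ {P = _≺ω i}
            (λ u → proj₁ (hit u))
            (λ u → let (_ , j≺i , y , p , _) = hit u in slot (proj₁ (g j≺i)) y p)
            (λ u → proj₁ (proj₂ (hit u)))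
            λ {u} {v} j≡ slot≡ →
              let (_ , j≺i , y , p , q) = hit u ; (_ , k≺i , y′ , p′ , q′) = hit v
                  y≡y′ = same-slot p p′ (cong proj₁ (g-cong j≺i k≺i j≡)) slot≡
              in away-injective (Φ-injective q (subst (λ z → (Φ (away v) , z) ∈ F) (sym y≡y′) q′))

      stage-live : ∃ (Stage i g)
      stage-live =
        let (t , t-avoids) = avoiding-points
            (u , u-avoids) = avoiding-fibres t
            (y , y∈) = proj₁ (proj₂ (proj₂ good)) (away t u)
            converges-Φ = proj₁ (proj₂ good)
        in (Φ t , y) , λ _ →
           (t , converges-Φ t) ,
           (Φ (away t u) , (away t u , converges-Φ (away t u)) , y∈) ,
           (λ p → Φ-disjoint (t≢away t u) (p , y∈)) ,
           t-avoids ,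
           (λ j≺i p → u-avoids j≺i (p , y∈))

    stage : ∀ i (g : ∀ {j} → j ≺ω i → Carrier X × Carrier Y) → ∃ (Stage i g)
    stage i g with em {P = Live i}
    ... | yes (active , good) = stage-live i g active good
    ... | no ¬live = (x₀ , y₀) , λ live → contradiction live ¬live

    stages : Σ[ G ∈ (2^ω → Carrier X × Carrier Y) ] (∀ i → Stage i (λ {j} _ → G j) (G i))
    stages = 2^ω-order.transfinite Stage stage

    xs : 2^ω → Carrier X
    xs i = proj₁ (proj₁ stages i)

    ys : 2^ω → Carrier Y
    ys i = proj₂ (proj₁ stages i)

    T : Subset (Carrier Y)
    T y = ∃[ i ] Live i × ys i ≡ y

    -- The later of the two stages rules out that the y of stage j lies in the fibre of `xs i`; if
    -- the stages coincide, the clause `(x , y) ∉ F` does.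
    xs-avoid-T : ∀ {i} → Live i → xs i ∉ preimage F T
    xs-avoid-T {i} live-i (_ , p , j , live-j , refl) with 2^ω-order.compare i j
    ... | inj₁ i≺j = proj₂ (proj₂ (proj₂ (proj₂ (proj₂ stages j live-j)))) i≺j p
    ... | inj₂ (inj₁ refl) = proj₁ (proj₂ (proj₂ (proj₂ stages i live-i))) p
    ... | inj₂ (inj₂ j≺i) = proj₁ (proj₂ (proj₂ (proj₂ (proj₂ stages i live-i)))) j≺i p

    nonmeasurable : CompletelyNonmeasurable X 𝓘 (preimage F T)
    nonmeasurable {B} (B-borel , B∉𝓘) =
      -- The scheme obtained by fusion inside `B` is treated at an active stage, and all points on
      -- its track lie in `B`.
      let (i , active , eq) = scheme-of-onto scheme
          live = active , subst Good (sym eq) scheme-good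
          on-track = on-track∈B i eq
          (x-on , (x′ , x′-on , p) , _) = proj₂ stages i live
      in (x′ , (ys i , p , i , live , refl) , on-track x′-on) ,
         (xs i , xs-avoid-T live , on-track x-on)
      where
      open Fusion B-borel B∉𝓘
      on-track∈B : ∀ i → scheme-of i ≡ scheme → ∀ {x} → OnTrack i x → x ∈ B
      on-track∈B i eq {x} (t , track→x) =
        subst B (X.limit-unique (proj₁ (proj₂ scheme-good) t)
          (subst (λ a → ConvergesTo X.metric (track a t) x) eq track→x)) (scheme-in-B t)

theorem2p4 : (∀ {a} → ExcludedMiddle a) → (∀ {a b} → Extensionality a b) →
    ∀ {ℓ} (X Y : TopologicalSpace ℓ) (𝓘 : Family (Carrier X)) →
    IsPolishIdealSpace X 𝓘 → IsCCC X 𝓘 →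
    IsPolish Y → IsUncountable (Carrier Y) →
    (F : Subset (Carrier X × Carrier Y)) → IsAnalytic (X ×ᵗ Y) F →
    (∀ y → horizontal F y ∈ 𝓘) →
    ∁ (image proj₁ F) ∈ 𝓘 →
    (∀ x → IsFinite (vertical F x)) →
    ∃[ T ] CompletelyNonmeasurable X 𝓘 (preimage F T)
theorem2p4 em ext X Y 𝓘 space ccc polishY _ F analytic horizontal∈𝓘 projection vertical-finite =
  T , nonmeasurable
  where
  open Classical em ext
  open Construction X Y 𝓘 space ccc polishY F analytic horizontal∈𝓘 projection vertical-finite
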